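{- Let $K$ be a field, $n\ge1$ an integer, and $E$ a finite directed graph such that $L_K(E)\cong M_n(K)$ as $K$-algebras. Then the number of edges of $E$ is at least $$N_n:=\max\{N\in\mathbb{N}\mid n\ge SP^N_*\}.$$
   Context: A directed graph $E=(E^0,E^1,s,t)$ has vertices $E^0$, edges $E^1$ and source and target maps $s,t\colon E^1\to E^0$ (multiple edges allowed). A finite path of length $m\ge1$ is a tuple $(e_1,\dots,e_m)$ of edges with $t(e_i)=s(e_{i+1})$, ending at $t(e_m)$; vertices are paths of length $0$. A sink is a vertex emitting no edges. Acyclic means there is no path of positive length with equal beginning and end; connected means any two vertices are joined by an undirected path. For $N\in\mathbb{N}$, $SP^N_*$ denotes the maximal number of finite paths ending in the sink, over all connected acyclic directed graphs with exactly $N$ edges and exactly one sink (so $SP^0_*=1$, from a single vertex). For a finite directed graph $E$ and a field $K$, the Leavitt path algebra $L_K(E)$ is the universal associative $K$-algebra generated by $\{v: v\in E^0\}\cup\{e,e^*: e\in E^1\}$ with relations: $vw=\delta_{v,w}v$ for $v,w\in E^0$; $s(e)e=e=e\,t(e)$ and $t(e)e^*=e^*=e^*s(e)$ for $e\in E^1$; $e^*f=\delta_{e,f}t(e)$ for $e,f\in E^1$; and $v=\sum_{e\in s^{ -1}(v)}ee^*$ for every vertex $v$ that is not a sink. -}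

module Defs where

open import Level using (_⊔_) renaming (suc to lsuc)
open import Algebra.Bundles using (CommutativeRing)
open import Algebra.Module.Bundles using (LeftModule)
open import Algebra.Module.Morphism.Structures using (module LeftModuleMorphisms)
open import Data.Nat using (ℕ; zero; suc; _≤_; _<_; z≤n; s≤s)
import Data.Nat.Properties as ℕ
open import Data.Nat.Solver using (module +-*-Solver)
open import Data.Fin using (Fin; zero; suc; splitAt; _↑ˡ_; _↑ʳ_)
import Data.Fin as Fin
import Data.Fin.Properties as Fin
open import Data.Fin.Induction using (spo-noetherian)
open import Data.List as List using (List; []; _∷_; _++_; length; filter; foldr; concatMap)
import Data.List.Properties as List
open import Data.List.Extrema.Nat using (argmax; argmax-all; f[xs]≤f[argmax])
open import Data.List.Relation.Unary.Any as Any using (Any; here)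
open import Data.List.Relation.Unary.All as All using (All; []; _∷_)
open import Data.List.Membership.Propositional using (_∈_; _∉_; lose)
open import Data.List.Membership.Propositional.Properties
  using (∈-filter⁺; ∈-filter⁻; ∈-allFin; ∈-map⁺; ∈-concatMap⁺; ∈-++⁺ˡ; ∈-++⁺ʳ; ∈-++⁻; ∈-map⁻)
open import Data.List.Membership.Setoid.Properties using (index-injective)
open import Data.Product using (∃-syntax; _×_; _,_; proj₁; proj₂)
open import Data.Sum as Sum using (_⊎_; inj₁; inj₂)
open import Function using (_∘_; _↔_; Inverse; mk↔ₛ′)
open import Function.Construct.Composition using (_↔-∘_)
open import Function.Construct.Identity using (↔-id)
open import Data.Sum.Function.Propositional using (_⊎-↔_)
open import Induction.WellFounded using (WellFounded; Acc; acc)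
open import Relation.Nullary using (¬_; Dec; yes; no; ¬?; contradiction; _×-dec_)
open import Relation.Binary.PropositionalEquality
  using (_≡_; _≢_; refl; sym; trans; cong; cong₂; subst; isEquivalence; setoid)
open import Relation.Binary.Construct.Closure.ReflexiveTransitive using (Star; ε; _◅_; _◅◅_)
open import Relation.Binary.Construct.Closure.Transitive as Plus using (TransClosure; [_]; _∷_)
open import Relation.Binary.Construct.Closure.Equivalence as Eq using (EqClosure)

------------------------------------------------------------------------
-- Fields and algebras

-- Neither decidable equality nor an apartness relation is assumed.
record Field c ℓ : Set (lsuc (c ⊔ ℓ)) where
  field
    commutativeRing : CommutativeRing c ℓ

  open CommutativeRing commutativeRing public

  field
    1≉0     : ¬ (1# ≈ 0#)
    inverse : ∀ x → ¬ (x ≈ 0#) → ∃[ y ] x * y ≈ 1#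

-- Associative K-algebras, not assumed to have a unit.
record Algebra {c ℓ} (K : Field c ℓ) a ℓa : Set (c ⊔ ℓ ⊔ lsuc (a ⊔ ℓa)) where
  infixl 7 _∙_
  field
    leftModule : LeftModule (Field.ring K) a ℓa

  open LeftModule leftModule public

  field
    _∙_      : Carrierᴹ → Carrierᴹ → Carrierᴹ
    ∙-cong   : ∀ {x x′ y y′} → x ≈ᴹ x′ → y ≈ᴹ y′ → x ∙ y ≈ᴹ x′ ∙ y′
    ∙-assoc  : ∀ x y z → (x ∙ y) ∙ z ≈ᴹ x ∙ (y ∙ z)
    distribˡ : ∀ x y z → x ∙ (y +ᴹ z) ≈ᴹ x ∙ y +ᴹ x ∙ z
    distribʳ : ∀ x y z → (y +ᴹ z) ∙ x ≈ᴹ y ∙ x +ᴹ z ∙ x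
    *ₗ-∙     : ∀ k x y → (k *ₗ x) ∙ y ≈ᴹ k *ₗ (x ∙ y)
    ∙-*ₗ     : ∀ k x y → x ∙ (k *ₗ y) ≈ᴹ k *ₗ (x ∙ y)

record _≅_ {c ℓ} {K : Field c ℓ} {a ℓa b ℓb}
           (A : Algebra K a ℓa) (B : Algebra K b ℓb) : Set (c ⊔ a ⊔ ℓa ⊔ b ⊔ ℓb) where
  private
    module A = Algebra A
    module B = Algebra B
  open LeftModuleMorphisms A.rawLeftModule B.rawLeftModule
  field
    ⟦_⟧                     : A.Carrierᴹ → B.Carrierᴹ
    isLeftModuleIsomorphism : IsLeftModuleIsomorphism ⟦_⟧
    ∙-homo                  : ∀ x y → ⟦ x A.∙ y ⟧ B.≈ᴹ (⟦ x ⟧ B.∙ ⟦ y ⟧)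

module _ {c ℓ} (K : Field c ℓ) where
  private module K = Field K
  open import Algebra.Properties.Semiring.Sum K.semiring
    using (sum; sum-cong-≋; ∑-distrib-+; ∑-comm; *-distribˡ-sum; *-distribʳ-sum)
  open import Relation.Binary.Reasoning.Setoid K.setoid

  MatrixAlgebra : ℕ → Algebra K c ℓ
  MatrixAlgebra n = record
    { leftModule = record
      { Carrierᴹ     = Fin n → Fin n → K.Carrier
      ; _≈ᴹ_         = λ X Y → ∀ i j → X i j K.≈ Y i j
      ; _+ᴹ_         = λ X Y i j → X i j K.+ Y i j
      ; _*ₗ_         = λ k X i j → k K.* X i j
      ; 0ᴹ           = λ i j → K.0#
      ; -ᴹ_          = λ X i j → K.- X i j
      ; isLeftModule = record
        { isLeftSemimodule = record
          { +ᴹ-isCommutativeMonoid = record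
            { isMonoid = record
              { isSemigroup = record
                { isMagma = record
                  { isEquivalence = record
                    { refl  = λ _ _ → K.refl
                    ; sym   = λ p i j → K.sym (p i j)
                    ; trans = λ p q i j → K.trans (p i j) (q i j)
                    }
                  ; ∙-cong = λ p q i j → K.+-cong (p i j) (q i j)
                  }
                ; assoc = λ _ _ _ _ _ → K.+-assoc _ _ _
                }
              ; identity = (λ _ _ _ → K.+-identityˡ _) , (λ _ _ _ → K.+-identityʳ _)
              }
            ; comm = λ _ _ _ _ → K.+-comm _ _
            }
          ; isPreleftSemimodule = record
            { *ₗ-cong      = λ k≈l p i j → K.*-cong k≈l (p i j)
            ; *ₗ-zeroˡ     = λ _ _ _ → K.zeroˡ _
            ; *ₗ-distribʳ  = λ _ _ _ _ _ → K.distribʳ _ _ _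
            ; *ₗ-identityˡ = λ _ _ _ → K.*-identityˡ _
            ; *ₗ-assoc     = λ _ _ _ _ _ → K.*-assoc _ _ _
            ; *ₗ-zeroʳ     = λ _ _ _ → K.zeroʳ _
            ; *ₗ-distribˡ  = λ _ _ _ _ _ → K.distribˡ _ _ _
            }
          }
        ; -ᴹ‿cong    = λ p i j → K.-‿cong (p i j)
        ; -ᴹ‿inverse = (λ _ _ _ → K.-‿inverseˡ _) , (λ _ _ _ → K.-‿inverseʳ _)
        }
      }
    ; _∙_      = λ X Y i j → sum λ l → X i l K.* Y l j
    ; ∙-cong   = λ p q i j → sum-cong-≋ λ l → K.*-cong (p i l) (q l j)
    ; ∙-assoc  = assoc
    ; distribˡ = λ X Y Z i j → K.trans
        (sum-cong-≋ λ l → K.distribˡ (X i l) (Y l j) (Z l j))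
        (∑-distrib-+ (λ l → X i l K.* Y l j) (λ l → X i l K.* Z l j))
    ; distribʳ = λ X Y Z i j → K.trans
        (sum-cong-≋ λ l → K.distribʳ (X l j) (Y i l) (Z i l))
        (∑-distrib-+ (λ l → Y i l K.* X l j) (λ l → Z i l K.* X l j))
    ; *ₗ-∙     = λ k X Y i j → K.trans
        (sum-cong-≋ λ l → K.*-assoc k (X i l) (Y l j))
        (K.sym (*-distribˡ-sum k (λ l → X i l K.* Y l j)))
    ; ∙-*ₗ     = λ k X Y i j → K.trans
        (sum-cong-≋ λ l → K.trans (K.sym (K.*-assoc (X i l) k (Y l j)))
          (K.trans (K.*-congʳ (K.*-comm (X i l) k)) (K.*-assoc k (X i l) (Y l j))))
        (K.sym (*-distribˡ-sum k (λ l → X i l K.* Y l j)))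
    }
    where
    assoc : (X Y Z : Fin n → Fin n → K.Carrier) → ∀ i j →
            sum (λ l → sum (λ m → X i m K.* Y m l) K.* Z l j)
              K.≈ sum (λ m → X i m K.* sum (λ l → Y m l K.* Z l j))
    assoc X Y Z i j = begin
      sum (λ l → sum (λ m → X i m K.* Y m l) K.* Z l j)
        ≈⟨ sum-cong-≋ (λ l → *-distribʳ-sum (Z l j) (λ m → X i m K.* Y m l)) ⟩
      sum (λ l → sum (λ m → X i m K.* Y m l K.* Z l j))
        ≈⟨ ∑-comm (λ l m → X i m K.* Y m l K.* Z l j) ⟩
      sum (λ m → sum (λ l → X i m K.* Y m l K.* Z l j))
        ≈⟨ sum-cong-≋ (λ m → sum-cong-≋ λ l → K.*-assoc (X i m) (Y m l) (Z l j)) ⟩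
      sum (λ m → sum (λ l → X i m K.* (Y m l K.* Z l j)))
        ≈⟨ sum-cong-≋ (λ m → K.sym (*-distribˡ-sum (X i m) (λ l → Y m l K.* Z l j))) ⟩
      sum (λ m → X i m K.* sum (λ l → Y m l K.* Z l j)) ∎

------------------------------------------------------------------------
-- Directed graphs

record FiniteDigraph : Set where
  field
    #vertices #edges : ℕ
    s t              : Fin #edges → Fin #vertices

  Vertex Edge : Set
  Vertex = Fin #vertices
  Edge   = Fin #edges

  Arrow : Vertex → Vertex → Set
  Arrow u v = ∃[ e ] (s e ≡ u × t e ≡ v)

  Path : Vertex → Vertex → Set
  Path = Star Arrow

  PathTo : Vertex → Set
  PathTo w = ∃[ u ] Path u w

  Sink : Vertex → Set
  Sink v = ∀ e → s e ≢ v

  Acyclic : Set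
  Acyclic = ∀ v → ¬ TransClosure Arrow v v

  Connected : Set
  Connected = ∀ u v → EqClosure Arrow u v

------------------------------------------------------------------------
-- Leavitt path algebras: formal expressions in the generators modulo the
-- least congruence containing the algebra axioms and the four relations

module Leavitt {c ℓ} (K : Field c ℓ) (E : FiniteDigraph) where
  private module K = Field K
  open FiniteDigraph E

  infixl 7 _∙_
  infixr 8 _·_
  infixl 6 _+_
  infix  4 _≈_

  data Expr : Set c where
    vertex : Vertex → Expr
    edge   : Edge → Expr
    ghost  : Edge → Expr
    0#     : Expr
    _+_    : Expr → Expr → Expr
    -_     : Expr → Expr
    _·_    : K.Carrier → Expr → Expr
    _∙_    : Expr → Expr → Expr

  ∑-emitted : Vertex → Expr
  ∑-emitted v =
    foldr _+_ 0# (List.map (λ e → edge e ∙ ghost e) (filter (λ e → s e Fin.≟ v) (List.allFin #edges)))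

  data _≈_ : Expr → Expr → Set (c ⊔ ℓ) where
    ≈-refl  : ∀ {x} → x ≈ x
    ≈-sym   : ∀ {x y} → x ≈ y → y ≈ x
    ≈-trans : ∀ {x y z} → x ≈ y → y ≈ z → x ≈ z
    +-cong  : ∀ {x x′ y y′} → x ≈ x′ → y ≈ y′ → x + y ≈ x′ + y′
    -‿cong  : ∀ {x x′} → x ≈ x′ → - x ≈ - x′
    ·-cong  : ∀ {k k′ x x′} → k K.≈ k′ → x ≈ x′ → k · x ≈ k′ · x′
    ∙-cong  : ∀ {x x′ y y′} → x ≈ x′ → y ≈ y′ → x ∙ y ≈ x′ ∙ y′

    +-assoc     : ∀ x y z → (x + y) + z ≈ x + (y + z)
    +-comm      : ∀ x y → x + y ≈ y + x
    +-identityˡ : ∀ x → 0# + x ≈ x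
    -‿inverseˡ  : ∀ x → (- x) + x ≈ 0#
    ·-distribˡ  : ∀ k x y → k · (x + y) ≈ k · x + k · y
    ·-distribʳ  : ∀ x k l → (k K.+ l) · x ≈ k · x + l · x
    ·-assoc     : ∀ k l x → (k K.* l) · x ≈ k · (l · x)
    ·-identityˡ : ∀ x → K.1# · x ≈ x
    ∙-assoc     : ∀ x y z → (x ∙ y) ∙ z ≈ x ∙ (y ∙ z)
    ∙-distribˡ  : ∀ x y z → x ∙ (y + z) ≈ x ∙ y + x ∙ z
    ∙-distribʳ  : ∀ x y z → (y + z) ∙ x ≈ y ∙ x + z ∙ x
    ·-∙         : ∀ k x y → (k · x) ∙ y ≈ k · (x ∙ y)
    ∙-·         : ∀ k x y → x ∙ (k · y) ≈ k · (x ∙ y)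

    v∙v  : ∀ v → vertex v ∙ vertex v ≈ vertex v
    v∙w  : ∀ {v w} → v ≢ w → vertex v ∙ vertex w ≈ 0#
    s∙e  : ∀ e → vertex (s e) ∙ edge e ≈ edge e
    e∙t  : ∀ e → edge e ∙ vertex (t e) ≈ edge e
    t∙e* : ∀ e → vertex (t e) ∙ ghost e ≈ ghost e
    e*∙s : ∀ e → ghost e ∙ vertex (s e) ≈ ghost e
    e*∙e : ∀ e → ghost e ∙ edge e ≈ vertex (t e)
    e*∙f : ∀ {e f} → e ≢ f → ghost e ∙ edge f ≈ 0#
    ck   : ∀ v → ¬ Sink v → vertex v ≈ ∑-emitted v

  private
    +-identityʳ : ∀ x → x + 0# ≈ x
    +-identityʳ x = ≈-trans (+-comm x 0#) (+-identityˡ x)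

    -‿inverseʳ : ∀ x → x + (- x) ≈ 0#
    -‿inverseʳ x = ≈-trans (+-comm x (- x)) (-‿inverseˡ x)

    x+x≈x⇒x≈0 : ∀ {x} → x + x ≈ x → x ≈ 0#
    x+x≈x⇒x≈0 {x} p =
      ≈-trans (≈-sym (+-identityˡ x))
      (≈-trans (+-cong (≈-sym (-‿inverseˡ x)) ≈-refl)
      (≈-trans (+-assoc (- x) x x)
      (≈-trans (+-cong ≈-refl p) (-‿inverseˡ x))))

    ·-zeroˡ : ∀ x → K.0# · x ≈ 0#
    ·-zeroˡ x = x+x≈x⇒x≈0
      (≈-trans (≈-sym (·-distribʳ x K.0# K.0#)) (·-cong (K.+-identityˡ K.0#) ≈-refl))

    ·-zeroʳ : ∀ k → k · 0# ≈ 0#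
    ·-zeroʳ k = x+x≈x⇒x≈0
      (≈-trans (≈-sym (·-distribˡ k 0# 0#)) (·-cong K.refl (+-identityˡ 0#)))

  algebra : Algebra K c (c ⊔ ℓ)
  algebra = record
    { leftModule = record
      { Carrierᴹ     = Expr
      ; _≈ᴹ_         = _≈_
      ; _+ᴹ_         = _+_
      ; _*ₗ_         = _·_
      ; 0ᴹ           = 0#
      ; -ᴹ_          = -_
      ; isLeftModule = record
        { isLeftSemimodule = record
          { +ᴹ-isCommutativeMonoid = record
            { isMonoid = record
              { isSemigroup = record
                { isMagma = record
                  { isEquivalence = record { refl = ≈-refl ; sym = ≈-sym ; trans = ≈-trans }
                  ; ∙-cong        = +-cong
                  }
                ; assoc = +-assoc
                }
              ; identity = +-identityˡ , +-identityʳ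
              }
            ; comm = +-comm
            }
          ; isPreleftSemimodule = record
            { *ₗ-cong      = ·-cong
            ; *ₗ-zeroˡ     = ·-zeroˡ
            ; *ₗ-distribʳ  = ·-distribʳ
            ; *ₗ-identityˡ = ·-identityˡ
            ; *ₗ-assoc     = ·-assoc
            ; *ₗ-zeroʳ     = ·-zeroʳ
            ; *ₗ-distribˡ  = ·-distribˡ
            }
          }
        ; -ᴹ‿cong    = -‿cong
        ; -ᴹ‿inverse = -‿inverseˡ , -‿inverseʳ
        }
      }
    ; _∙_      = _∙_
    ; ∙-cong   = ∙-cong
    ; ∙-assoc  = ∙-assoc
    ; distribˡ = ∙-distribˡ
    ; distribʳ = ∙-distribʳ
    ; *ₗ-∙     = ·-∙
    ; ∙-*ₗ     = ∙-·
    }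

LeavittPathAlgebra : ∀ {c ℓ} (K : Field c ℓ) → FiniteDigraph → Algebra K c (c ⊔ ℓ)
LeavittPathAlgebra K E = Leavitt.algebra K E

------------------------------------------------------------------------
-- The maximal number SP N of paths ending in the sink

open import Data.Nat using (_+_; _*_)

-- There is a connected acyclic directed graph with exactly N edges, exactly
-- one sink, and exactly k finite paths ending in that sink.  (A connected
-- graph with finitely many edges has finitely many vertices.)
record SinkPaths (N k : ℕ) : Set where
  field
    graph : FiniteDigraph
  open FiniteDigraph graph
  field
    edges     : #edges ≡ N
    connected : Connected
    acyclic   : Acyclic
    sink      : Vertex
    isSink    : Sink sink
    unique    : ∀ {v} → Sink v → v ≡ sink
    count     : Fin k ↔ PathTo sink

IsMaximum : (ℕ → Set) → ℕ → Set
IsMaximum P m = P m × (∀ k → P k → k ≤ m)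

-- What follows, up to the definition of SP, shows that the maximum exists:
-- it is the largest value 1 + d₁ (1 + d₂ (1 + … (1 + dᵣ))) over the
-- compositions N = d₁ + … + dᵣ.  A part dᵢ is stored as its predecessor.

private
  size : List ℕ → ℕ
  size []       = 0
  size (d ∷ ds) = suc d + size ds

  tally : List ℕ → ℕ
  tally []       = 0
  tally (d ∷ ds) = suc d * suc (tally ds)

  module _ {G : FiniteDigraph} where
    open FiniteDigraph G

    Arrow-≡ : ∀ {u v} {x y : Arrow u v} → proj₁ x ≡ proj₁ y → x ≡ y
    Arrow-≡ {x = e , refl , refl} {.e , refl , refl} refl = refl

  -- Attach to the sink w of G a new sink by a + 1 parallel edges.
  module Extend (G : FiniteDigraph) (w : FiniteDigraph.Vertex G) (a : ℕ) where
    open FiniteDigraph G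

    src tgt : Fin (suc a) ⊎ Edge → Fin (suc #vertices)
    src (inj₁ _) = suc w
    src (inj₂ e) = suc (s e)
    tgt (inj₁ _) = zero
    tgt (inj₂ e) = suc (t e)

    G⁺ : FiniteDigraph
    G⁺ = record
      { #vertices = suc #vertices
      ; #edges    = suc a + #edges
      ; s         = src ∘ splitAt (suc a)
      ; t         = tgt ∘ splitAt (suc a)
      }
    module G⁺ = FiniteDigraph G⁺

    new : Fin (suc a) → G⁺.Arrow (suc w) zero
    new i = i ↑ˡ #edges
          , cong src (Fin.splitAt-↑ˡ (suc a) i #edges)
          , cong tgt (Fin.splitAt-↑ˡ (suc a) i #edges)

    old : ∀ {u v} → Arrow u v → G⁺.Arrow (suc u) (suc v)
    old (e , refl , refl) = suc a ↑ʳ e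
          , cong src (Fin.splitAt-↑ʳ (suc a) #edges e)
          , cong tgt (Fin.splitAt-↑ʳ (suc a) #edges e)

    old-index : ∀ {u v} (x : Arrow u v) → proj₁ (old x) ≡ suc a ↑ʳ proj₁ x
    old-index (e , refl , refl) = refl

    data View {u v} (x : G⁺.Arrow u v) : Set where
      isNew : ∀ i → i ↑ˡ #edges ≡ proj₁ x → u ≡ suc w → v ≡ zero → View x
      isOld : ∀ {u′ v′} (y : Arrow u′ v′) → suc a ↑ʳ proj₁ y ≡ proj₁ x →
              u ≡ suc u′ → v ≡ suc v′ → View x

    view : ∀ {u v} (x : G⁺.Arrow u v) → View x
    view {u} {v} x@(e , p , q) = go (splitAt (suc a) e) refl p q
      where
      go : ∀ z → splitAt (suc a) e ≡ z → src z ≡ u →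
           tgt z ≡ v → View x
      go (inj₁ i) eq p q = isNew i (Fin.splitAt⁻¹-↑ˡ eq) (sym p) (sym q)
      go (inj₂ j) eq p q = isOld (j , refl , refl) (Fin.splitAt⁻¹-↑ʳ eq) (sym p) (sym q)

    noArrow : ∀ {v} → ¬ G⁺.Arrow zero v
    noArrow x with view x
    ... | isNew _ _ () _
    ... | isOld _ _ () _

    new≢old : ∀ {i j} → i ↑ˡ #edges ≢ suc a ↑ʳ j
    new≢old {i} {j} eq
      with () ← trans (sym (Fin.splitAt-↑ˡ (suc a) i #edges))
                (trans (cong (splitAt (suc a)) eq) (Fin.splitAt-↑ʳ (suc a) #edges j))

    to : ∀ {u} → G⁺.Path (suc u) zero → Fin (suc a) × Path u w
    to (x ◅ p) with view x
    ... | isNew i _ refl refl = i , ε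
    ... | isOld y _ refl refl = proj₁ (to p) , y ◅ proj₂ (to p)

    from : ∀ {u} → Fin (suc a) → Path u w → G⁺.Path (suc u) zero
    from i ε       = new i ◅ ε
    from i (y ◅ p) = old y ◅ from i p

    to∘from : ∀ {u} i (p : Path u w) → to (from i p) ≡ (i , p)
    to∘from i ε with view (new i)
    ... | isNew j eq refl refl = cong (_, ε) (Fin.↑ˡ-injective #edges j i eq)
    ... | isOld y eq _ ()
    to∘from i (y ◅ p) with view (old y)
    ... | isNew j eq _ ()
    ... | isOld z eq refl refl
      rewrite Arrow-≡ {G} {x = z} {y} (Fin.↑ʳ-injective (suc a) _ _ (trans eq (old-index y)))
            | to∘from i p = refl

    from∘to : ∀ {u} (p : G⁺.Path (suc u) zero) → from (proj₁ (to p)) (proj₂ (to p)) ≡ p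
    from∘to (x ◅ p) with view x
    from∘to (x ◅ ε) | isNew i eq refl refl = cong (_◅ ε) (Arrow-≡ {G⁺} eq)
    from∘to (x ◅ (y ◅ p)) | isNew i eq refl refl = contradiction y noArrow
    from∘to (x ◅ p) | isOld y eq refl refl =
      cong₂ _◅_ (Arrow-≡ {G⁺} (trans (old-index y) eq)) (from∘to p)

    module _ {k} (count : Fin k ↔ PathTo w) where
      private module C = Inverse count

      Code : Set
      Code = Fin 1 ⊎ (Fin (suc a) × Fin k)

      encode : G⁺.PathTo zero → Code
      encode (zero  , _) = inj₁ zero
      encode (suc u , p) = inj₂ (proj₁ (to p) , C.from (u , proj₂ (to p)))

      decode : Code → G⁺.PathTo zero
      decode (inj₁ _)       = zero , ε
      decode (inj₂ (i , j)) = suc (proj₁ (C.to j)) , from i (proj₂ (C.to j))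

      encode∘decode : ∀ c → encode (decode c) ≡ c
      encode∘decode (inj₁ zero) = refl
      encode∘decode (inj₂ (i , j)) rewrite to∘from i (proj₂ (C.to j)) =
        cong (λ z → inj₂ (i , z)) (C.strictlyInverseʳ j)

      decode∘encode : ∀ p → decode (encode p) ≡ p
      decode∘encode (zero , ε)     = refl
      decode∘encode (zero , x ◅ p) = contradiction x noArrow
      decode∘encode (suc u , p) rewrite C.strictlyInverseˡ (u , proj₂ (to p)) =
        cong (suc u ,_) (from∘to p)

      count⁺ : Fin (1 + suc a * k) ↔ G⁺.PathTo zero
      count⁺ = mk↔ₛ′ decode encode decode∘encode encode∘decode
        ↔-∘ ((↔-id (Fin 1) ⊎-↔ Fin.*↔×) ↔-∘ Fin.+↔⊎)

    connected⁺ : Connected → G⁺.Connected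
    connected⁺ conn = go
      where
      up : ∀ u → EqClosure G⁺.Arrow (suc u) zero
      up u = Eq.gmap suc old (conn u w) ◅◅ Eq.return (new zero)
      go : G⁺.Connected
      go zero    zero    = ε
      go zero    (suc v) = Eq.symmetric _ (up v)
      go (suc u) zero    = up u
      go (suc u) (suc v) = Eq.gmap suc old (conn u v)

    acyclic⁺ : Acyclic → G⁺.Acyclic
    acyclic⁺ ac = go
      where
      none : ∀ {v} → ¬ TransClosure G⁺.Arrow zero v
      none [ x ]   = noArrow x
      none (x ∷ _) = noArrow x
      lower : ∀ {x y u v} → TransClosure G⁺.Arrow x y → x ≡ suc u → y ≡ suc v → TransClosure Arrow u v
      lower [ x ] p q with view x
      lower [ x ] refl () | isNew _ _ _ refl
      lower [ x ] refl refl | isOld y _ refl refl = [ y ]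
      lower (x ∷ c) p q with view x
      lower (x ∷ c) refl q | isNew _ _ _ refl = contradiction c none
      lower (x ∷ c) refl q | isOld y _ refl refl = y ∷ lower c refl q

      go : G⁺.Acyclic
      go zero    c = none c
      go (suc v) c = ac v (lower c refl refl)

    isSink⁺ : G⁺.Sink zero
    isSink⁺ e eq = noArrow (e , eq , refl)

    unique⁺ : (∀ {v} → Sink v → v ≡ w) → ∀ {v} → G⁺.Sink v → v ≡ zero
    unique⁺ uniq {zero}  _  = refl
    unique⁺ uniq {suc v} sk with refl ← uniq {v} (λ e eq → let (f , p , _) = old (e , eq , refl) in sk f p) =
      contradiction (proj₁ (proj₂ (new zero))) (sk (proj₁ (new zero)))

attach : ∀ {N k} d → SinkPaths N k → SinkPaths (suc d + N) (1 + suc d * k)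
attach d S = record
  { graph     = G⁺
  ; edges     = cong (suc d +_) S.edges
  ; connected = connected⁺ S.connected
  ; acyclic   = acyclic⁺ S.acyclic
  ; sink      = zero
  ; isSink    = isSink⁺
  ; unique    = unique⁺ S.unique
  ; count     = count⁺ S.count
  }
  where
  module S = SinkPaths S
  open Extend S.graph S.sink d

private
  attained : ∀ ds → SinkPaths (size ds) (suc (tally ds))
  attained [] = record
    { graph     = record { #vertices = 1 ; #edges = 0 ; s = λ () ; t = λ () }
    ; edges     = refl
    ; connected = λ { zero zero → ε }
    ; acyclic   = λ { v [ () , _ ] ; v ((() , _) ∷ _) }
    ; sink      = zero
    ; isSink    = λ ()
    ; unique    = λ { {zero} _ → refl }
    ; count     = mk↔ₛ′ (λ _ → zero , ε) (λ _ → zero)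
                    (λ { (zero , ε) → refl ; (zero , (() , _) ◅ _) }) (λ { zero → refl })
    }
  attained (d ∷ ds) = attach d (attained ds)

  filter-split : ∀ {A : Set} {P : A → Set} (P? : ∀ x → Dec (P x)) xs →
                 length (filter P? xs) + length (filter (¬? ∘ P?) xs) ≡ length xs
  filter-split P? [] = refl
  filter-split P? (x ∷ xs) with P? x
  ... | yes _ = cong suc (filter-split P? xs)
  ... | no _  = trans (ℕ.+-suc _ _) (cong suc (filter-split P? xs))

  length-++-≤ : ∀ {A : Set} (xs : List A) {ys a b} → length xs ≤ a → length ys ≤ b →
                length (xs ++ ys) ≤ a + b
  length-++-≤ xs xs≤ ys≤ = ℕ.≤-trans (ℕ.≤-reflexive (List.length-++ xs)) (ℕ.+-mono-≤ xs≤ ys≤)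

  length-concatMap : ∀ {A B : Set} (f : A → List B) {b} → (∀ x → length (f x) ≤ b) →
                     ∀ xs → length (concatMap f xs) ≤ length xs * b
  length-concatMap f bound [] = z≤n
  length-concatMap f bound (x ∷ xs) =
    length-++-≤ (f x) (bound x) (length-concatMap f bound xs)

  -- The vertices are listed in an order in which every vertex comes after the
  -- targets of its edges; R and ES are the vertices not listed yet and the
  -- edges they emit, b bounds the number of paths to w from each listed
  -- vertex, and c the total number of paths to w from listed vertices.
  module Bound (G : FiniteDigraph) (acyclic : FiniteDigraph.Acyclic G) (w : FiniteDigraph.Vertex G)
               (isSink : FiniteDigraph.Sink G w)
               (unique : ∀ {v} → FiniteDigraph.Sink G v → v ≡ w) where
    open FiniteDigraph G
    open import Data.List.Membership.DecPropositional (Fin._≟_ {#vertices}) using (_∈?_)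

    noetherian : WellFounded (λ v u → TransClosure Arrow u v)
    noetherian = spo-noetherian {_≈_ = _≡_} record
      { isEquivalence = isEquivalence
      ; irrefl        = λ { refl c → acyclic _ c }
      ; trans         = Plus._++_
      ; <-resp-≈      = (λ { refl c → c }) , (λ { refl c → c })
      }

    record State (R : List Vertex) (ES : List Edge) (b c : ℕ) : Set where
      field
        paths    : ∀ {u} → u ∉ R → ∃[ ps ] (∀ (p : Path u w) → p ∈ ps) × length ps ≤ b
        allPaths : ∃[ ps ] (∀ {u} → u ∉ R → ∀ (p : Path u w) → (u , p) ∈ ps) × length ps ≤ c
        ES⁺      : ∀ {e} → s e ∈ R → e ∈ ES
        ES⁻      : ∀ {e} → e ∈ ES → s e ∈ R
        w∉R      : w ∉ R

    -- an unlisted vertex all of whose edges end in listed vertices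
    next : ∀ R {u} → u ∈ R → Acc (λ v u → TransClosure Arrow u v) u →
           ∃[ v ] v ∈ R × (∀ e → s e ≡ v → t e ∉ R)
    next R {u} u∈R (acc rec)
      with Fin.any? (λ e → (s e Fin.≟ u) ×-dec (t e ∈? R))
    ... | yes (e , se≡u , te∈R) = next R te∈R (rec [ e , se≡u , refl ])
    ... | no none = u , u∈R , λ e se≡u te∈R → none (e , se≡u , te∈R)

    emits : ∀ v → v ≢ w → ∃[ e ] s e ≡ v
    emits v v≢w with Fin.any? (λ e → s e Fin.≟ v)
    ... | yes found = found
    ... | no none   = contradiction (unique (λ e eq → none (e , eq))) v≢w

    module Step {R ES b c} (S : State R ES b c) v (v∈R : v ∈ R) (low : ∀ e → s e ≡ v → t e ∉ R) where
      open State S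

      R′ : List Vertex
      R′ = filter (λ u → ¬? (u Fin.≟ v)) R

      out ES′ : List Edge
      out = filter (λ e → s e Fin.≟ v) ES
      ES′ = filter (λ e → ¬? (s e Fin.≟ v)) ES

      v≢w : v ≢ w
      v≢w refl = w∉R v∈R

      out≢[] : ∃[ d ] length out ≡ suc d
      out≢[] with emits v v≢w
      ... | e , refl with out | ∈-filter⁺ (λ e → s e Fin.≟ v) (ES⁺ v∈R) refl
      ...   | _ ∷ out′ | _ = length out′ , refl

      through : Edge → List (Path v w)
      through e with s e Fin.≟ v
      ... | yes se≡v = List.map ((e , se≡v , refl) ◅_) (proj₁ (paths (low e se≡v)))
      ... | no _     = []

      through-bound : ∀ e → length (through e) ≤ b
      through-bound e with s e Fin.≟ v
      ... | yes se≡v = ℕ.≤-trans (ℕ.≤-reflexive (List.length-map _ (proj₁ (paths (low e se≡v)))))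
                         (proj₂ (proj₂ (paths (low e se≡v))))
      ... | no _     = z≤n

      through-complete : ∀ e (eq : s e ≡ v) (p : Path (t e) w) → (e , eq , refl) ◅ p ∈ through e
      through-complete e refl p with s e Fin.≟ s e
      ... | yes refl = ∈-map⁺ _ (proj₁ (proj₂ (paths (low e refl))) p)
      ... | no ≢     = contradiction refl ≢

      pathsᵥ : List (Path v w)
      pathsᵥ = concatMap through out

      pathsᵥ-complete : ∀ p → p ∈ pathsᵥ
      pathsᵥ-complete ε = contradiction refl v≢w
      pathsᵥ-complete ((e , refl , refl) ◅ p) =
        ∈-concatMap⁺ through (lose (∈-filter⁺ (λ e → s e Fin.≟ v) (ES⁺ v∈R) refl) (through-complete e refl p))

      tag : Path v w → PathTo w
      tag p = v , p

      unlisted : ∀ {u} → u ∉ R′ → u ≢ v → u ∉ R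
      unlisted u∉R′ u≢v u∈R = u∉R′ (∈-filter⁺ (λ u → ¬? (u Fin.≟ v)) u∈R u≢v)

      state : State R′ ES′ (length out * b) (length out * b + c)
      state = record
        { paths    = paths′
        ; allPaths = List.map tag pathsᵥ ++ proj₁ allPaths , complete
                   , length-++-≤ (List.map tag pathsᵥ)
                       (ℕ.≤-trans (ℕ.≤-reflexive (List.length-map tag pathsᵥ))
                         (length-concatMap through through-bound out))
                       (proj₂ (proj₂ allPaths))
        ; ES⁺      = λ se∈R′ → let (se∈R , se≢v) = ∈-filter⁻ (λ u → ¬? (u Fin.≟ v)) {xs = R} se∈R′ in
                       ∈-filter⁺ (λ e → ¬? (s e Fin.≟ v)) (ES⁺ se∈R) se≢v
        ; ES⁻      = λ e∈ES′ → let (e∈ES , se≢v) = ∈-filter⁻ (λ e → ¬? (s e Fin.≟ v)) {xs = ES} e∈ES′ in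
                       ∈-filter⁺ (λ u → ¬? (u Fin.≟ v)) (ES⁻ e∈ES) se≢v
        ; w∉R      = λ w∈R′ → w∉R (proj₁ (∈-filter⁻ (λ u → ¬? (u Fin.≟ v)) {xs = R} w∈R′))
        }
        where
        b≤ : b ≤ length out * b
        b≤ with out≢[]
        ... | d , eq rewrite eq = ℕ.m≤m+n b (d * b)
        paths′ : ∀ {u} → u ∉ R′ → ∃[ ps ] (∀ (p : Path u w) → p ∈ ps) × length ps ≤ length out * b
        paths′ {u} u∉R′ with u Fin.≟ v
        ... | yes refl = pathsᵥ , pathsᵥ-complete , length-concatMap through through-bound out
        ... | no u≢v   = let (ps , all , bound) = paths (unlisted u∉R′ u≢v) in ps , all , ℕ.≤-trans bound b≤
        complete : ∀ {u} → u ∉ R′ → ∀ (p : Path u w) → (u , p) ∈ List.map tag pathsᵥ ++ proj₁ allPaths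
        complete {u} u∉R′ p with u Fin.≟ v
        ... | yes refl = ∈-++⁺ˡ (∈-map⁺ tag (pathsᵥ-complete p))
        ... | no u≢v   = ∈-++⁺ʳ _ (proj₁ (proj₂ allPaths) (unlisted u∉R′ u≢v) p)

    Result : ℕ → ℕ → ℕ → Set
    Result m b c = ∃[ ds ] size ds ≡ m × ∃[ ps ] (∀ (p : PathTo w) → p ∈ ps) × length ps ≤ c + b * tally ds

    run : ∀ r {R ES b c} → length R ≤ r → State R ES b c → Result (length ES) b c
    run r {[]} {[]} {b} {c} _ S = [] , refl , proj₁ allPaths , (λ (u , p) → proj₁ (proj₂ allPaths) (λ ()) p)
      , ℕ.≤-trans (proj₂ (proj₂ allPaths)) (ℕ.m≤m+n c (b * 0))
      where open State S
    run r {[]} {e ∷ ES} _ S with () ← State.ES⁻ S (here refl)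
    run (suc r) {R@(x ∷ _)} {ES} {b} {c} (s≤s |R|≤r) S
      with next R (here refl) (noetherian x)
    ... | v , v∈R , low
      with Step.out≢[] S v v∈R low
         | run r (ℕ.≤-trans (ℕ.≤-pred (List.filter-notAll (λ u → ¬? (u Fin.≟ v)) R
                   (Any.map (λ { refl ≢ → ≢ refl }) v∈R))) |R|≤r) (Step.state S v v∈R low)
    ... | d , |out|≡1+d | ds , size≡ , ps , all , bound =
      d ∷ ds
      , trans (cong₂ _+_ (sym |out|≡1+d) size≡) (filter-split (λ e → s e Fin.≟ v) ES)
      , ps , all
      , ℕ.≤-trans bound (ℕ.≤-reflexive (trans (cong (λ o → o * b + c + o * b * tally ds) |out|≡1+d)
          (solve 4 (λ o b c g → o :* b :+ c :+ o :* b :* g := c :+ b :* (o :* (con 1 :+ g))) refl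
            (suc d) b c (tally ds))))
      where open +-*-Solver

    initial : State (filter (λ u → ¬? (u Fin.≟ w)) (List.allFin #vertices)) (List.allFin #edges) 1 1
    initial = record
      { paths    = paths
      ; allPaths = (w , ε) ∷ [] , allPaths , ℕ.≤-refl
      ; ES⁺      = λ {e} _ → ∈-allFin e
      ; ES⁻      = λ {e} _ → ∈-filter⁺ (λ u → ¬? (u Fin.≟ w)) (∈-allFin (s e)) (isSink e)
      ; w∉R      = λ w∈R → proj₂ (∈-filter⁻ (λ u → ¬? (u Fin.≟ w)) {xs = List.allFin #vertices} w∈R) refl
      }
      where
      listed : ∀ {u} → u ∉ filter (λ u → ¬? (u Fin.≟ w)) (List.allFin #vertices) → u ≡ w
      listed {u} u∉ with u Fin.≟ w
      ... | yes u≡w = u≡w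
      ... | no u≢w  = contradiction (∈-filter⁺ (λ u → ¬? (u Fin.≟ w)) (∈-allFin u) u≢w) u∉
      empty : (p : Path w w) → p ≡ ε
      empty ε = refl
      empty ((e , se≡w , _) ◅ _) = contradiction se≡w (isSink e)
      paths : ∀ {u} → u ∉ _ → ∃[ ps ] (∀ (p : Path u w) → p ∈ ps) × length ps ≤ 1
      paths u∉ with refl ← listed u∉ = ε ∷ [] , (λ p → here (empty p)) , ℕ.≤-refl
      allPaths : ∀ {u} → u ∉ _ → ∀ (p : Path u w) → (u , p) ∈ (w , ε) ∷ []
      allPaths u∉ p with refl ← listed u∉ = here (cong (w ,_) (empty p))

  bounded : ∀ {N k} → SinkPaths N k → ∃[ ds ] size ds ≡ N × k ≤ suc (tally ds)
  bounded S with Bound.run graph acyclic sink isSink unique _ ℕ.≤-refl (Bound.initial graph acyclic sink isSink unique)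
    where open SinkPaths S
  ... | ds , size≡ , ps , all , bound = ds
    , trans size≡ (trans (List.length-tabulate _) edges)
    , ℕ.≤-trans (Fin.injective⇒≤ {f = λ i → Any.index (all (C.to i))}
        (λ {i} {j} eq → trans (sym (C.strictlyInverseʳ i)) (trans
          (cong C.from (index-injective (setoid _) (all (C.to i)) (all (C.to j)) eq)) (C.strictlyInverseʳ j))))
        (subst (λ g → length ps ≤ suc g) (ℕ.+-identityʳ (tally ds)) bound)
    where
    open SinkPaths S
    module C = Inverse count

  grow : List ℕ → List ℕ
  grow []       = 0 ∷ []
  grow (d ∷ ds) = suc d ∷ ds

  compositions : ℕ → List (List ℕ)
  compositions zero    = [] ∷ []
  compositions (suc N) = List.map (0 ∷_) (compositions N) ++ List.map grow (compositions N)

  size-compositions : ∀ N {ds} → ds ∈ compositions N → size ds ≡ N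
  size-compositions zero (here refl) = refl
  size-compositions (suc N) ds∈ with ∈-++⁻ (List.map (0 ∷_) (compositions N)) ds∈
  ... | inj₁ ds∈′ with _ , es∈ , refl ← ∈-map⁻ (0 ∷_) ds∈′ = cong suc (size-compositions N es∈)
  ... | inj₂ ds∈′ with ∈-map⁻ grow ds∈′
  ...   | []    , es∈ , refl = cong suc (size-compositions N es∈)
  ...   | _ ∷ _ , es∈ , refl = cong suc (size-compositions N es∈)

  compositions-complete : ∀ N ds → size ds ≡ N → ds ∈ compositions N
  compositions-complete zero    []           _  = here refl
  compositions-complete (suc N) (zero ∷ ds)  eq =
    ∈-++⁺ˡ (∈-map⁺ (0 ∷_) (compositions-complete N ds (ℕ.suc-injective eq)))
  compositions-complete (suc N) (suc d ∷ ds) eq =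
    ∈-++⁺ʳ _ (∈-map⁺ grow (compositions-complete N (d ∷ ds) (ℕ.suc-injective eq)))

  size-ones : ∀ N → size (List.replicate N 0) ≡ N
  size-ones zero    = refl
  size-ones (suc N) = cong suc (size-ones N)

  tally-ones : ∀ N → tally (List.replicate N 0) ≡ N
  tally-ones zero    = refl
  tally-ones (suc N) = cong suc (trans (ℕ.+-identityʳ _) (tally-ones N))

  best : ℕ → List ℕ
  best N = argmax tally (List.replicate N 0) (compositions N)

SP-maximum : ∀ N → ∃[ m ] IsMaximum (SinkPaths N) m
SP-maximum N = suc (tally (best N))
  , subst (λ N′ → SinkPaths N′ (suc (tally (best N))))
      (argmax-all tally {P = λ ds → size ds ≡ N} (size-ones N) (All.tabulate (size-compositions N)))
      (attained (best N))
  , λ k S → let (ds , size≡ , k≤) = bounded S in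
      ℕ.≤-trans k≤ (s≤s (All.lookup (f[xs]≤f[argmax] {f = tally} (List.replicate N 0) (compositions N))
        (compositions-complete N ds size≡)))

SP : ℕ → ℕ
SP N = proj₁ (SP-maximum N)

private
  N<SP : ∀ N → N < SP N
  N<SP N = proj₂ (proj₂ (SP-maximum N)) (suc N)
    (subst (λ m → SinkPaths m (suc N)) (size-ones N)
      (subst (λ m → SinkPaths (size (List.replicate N 0)) (suc m)) (tally-ones N) (attained (List.replicate N 0))))

  search : ∀ {P : ℕ → Set} → (∀ k → Dec (P k)) → P 0 → ∀ b → (∀ k → P k → k ≤ b) → ∃[ m ] IsMaximum P m
  search P? p0 zero    bound = 0 , p0 , bound
  search P? p0 (suc b) bound with P? (suc b)
  ... | yes p = suc b , p , bound
  ... | no ¬p = search P? p0 b λ k pk → ℕ.≤-pred (ℕ.≤∧≢⇒< (bound k pk) (λ { refl → ¬p pk }))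

edgeBound-maximum : ∀ n → 1 ≤ n → ∃[ m ] IsMaximum (λ N → SP N ≤ n) m
edgeBound-maximum n 1≤n =
  search (λ N → SP N ℕ.≤? n) 1≤n n (λ N SP≤n → ℕ.<⇒≤ (ℕ.<-≤-trans (N<SP N) SP≤n))

-- max { N ∣ n ≥ SP N }
edgeBound : ∀ n → 1 ≤ n → ℕ
edgeBound n 1≤n = proj₁ (edgeBound-maximum n 1≤n)

{-# OPTIONS --safe #-}
module Submission where

-- A closed path p of positive length at v gives n² + 1 powers whose images in Mₙ(K) are linearly
-- dependent; as the powers have distinct degrees, and L acts on two-sided series with coefficients in L
-- so that degrees separate, one of them vanishes, and v = p* p = 0.  So nonzero vertices lie on no
-- cycle, and following edges between them leads to a nonzero sink w.  The vertices from which w can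
-- be reached span a connected acyclic graph with the only sink w.  The left ideal L w is spanned by
-- the k paths ending in w and maps onto Mₙ(K)⟦w⟧, which has a column of full rank; hence n ≤ k ≤ SP m
-- where m is the number of edges of E.  Finally, SP is strictly increasing.
--
-- Equality in K is undecidable, so the case distinctions are made under a double negation.

open import Level using (Level; _⊔_)
open import Algebra.Bundles using (CommutativeMonoid)
open import Algebra.Module.Morphism.Structures using (module LeftModuleMorphisms)
open import Data.Bool.Properties using (T?; T-irrelevant)
open import Data.Fin as Fin using (Fin; zero; suc; toℕ; punchIn; quotient; remainder; combine)
open import Data.Fin.Induction using (spo-noetherian)
import Data.Fin.Properties as Fin
open import Data.Integer as ℤ using (ℤ; +_)
import Data.Integer.Properties as ℤ
open import Data.List as List using (List; []; _∷_; length; filter)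
open import Data.Nat as ℕ using (ℕ; zero; suc; _≤_; _<_; z≤n; s≤s; _≤′_; ≤′-refl; ≤′-step)
import Data.Nat.Properties as ℕ
open import Data.Product using (Σ; Σ-syntax; ∃-syntax; _×_; _,_; proj₁; proj₂)
open import Data.Product.Properties using (Σ-≡,≡→≡)
open import Data.Sum using (_⊎_; inj₁; inj₂)
open import Data.Sum.Function.Propositional using (_⊎-↔_)
open import Data.Vec.Functional using (insertAt; removeAt)
open import Data.Vec.Functional.Properties using (insertAt-lookup; insertAt-punchIn)
open import Function using (_∘_; _↔_; Inverse; mk↔ₛ′)
open import Function.Construct.Composition using (_↔-∘_)
open import Induction.WellFounded using (WellFounded; Acc; acc)
open import Relation.Binary using (Rel)
open import Relation.Binary.Construct.Closure.Equivalence using (symmetric)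
open import Relation.Binary.Construct.Closure.ReflexiveTransitive as Star using (ε; _◅_; _◅◅_)
open import Relation.Binary.Construct.Closure.Symmetric using (fwd)
open import Relation.Binary.Construct.Closure.Transitive as Plus using (TransClosure; [_]; _∷_)
open import Relation.Binary.PropositionalEquality as ≡ using (_≡_; _≢_; refl)
open import Relation.Nullary using (¬_; Dec; yes; no; contradiction; Irrelevant; ¬?; _×-dec_)
open import Relation.Nullary.Decidable
  using (True; toWitness; fromWitness; decidable-stable; ¬¬-excluded-middle)

open import Defs

private variable
  a b : Level

¬¬-∀-Fin : ∀ {n} {P : Fin n → Set a} → (∀ i → ¬ ¬ P i) → ¬ ¬ (∀ i → P i)
¬¬-∀-Fin {n = zero}  _   k = k λ ()
¬¬-∀-Fin {n = suc n} ¬¬P k =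
  ¬¬P zero λ p → ¬¬-∀-Fin (¬¬P ∘ suc) λ ps → k λ { zero → p ; (suc i) → ps i }

¬¬-decidable : ∀ {n} (P : Fin n → Set a) → ¬ ¬ (∀ i → Dec (P i))
¬¬-decidable P = ¬¬-∀-Fin λ _ → ¬¬-excluded-middle

Finite : Set a → Set a
Finite A = ∃[ k ] (Fin k ↔ A)

finite-⊎ : {A : Set a} {B : Set b} → Finite A → Finite B → Finite (A ⊎ B)
finite-⊎ (_ , f) (_ , g) = _ , (f ⊎-↔ g) ↔-∘ Fin.+↔⊎

finite-dec : {A : Set a} → Dec A → Irrelevant A → Finite A
finite-dec (yes x) irr = 1 , mk↔ₛ′ (λ _ → x) (λ _ → zero) (irr x) λ { zero → refl }
finite-dec (no ¬x) irr = 0 , mk↔ₛ′ (λ ()) (λ x → contradiction x ¬x) (λ x → contradiction x ¬x) λ ()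

finite-↔ : {A : Set a} {B : Set b} → A ↔ B → Finite A → Finite B
finite-↔ f (k , g) = k , f ↔-∘ g

finite-Σ-dec : {A : Set a} {B : A → Set b} → Dec A → Irrelevant A →
               (∀ x → Finite (B x)) → Finite (Σ A B)
finite-Σ-dec {A = A} {B} (yes x) irr fin = finite-↔ iso (fin x)
  where
  move : ∀ {y z} → y ≡ z → B y → B z
  move = ≡.subst B
  move-refl : ∀ {y} (p : y ≡ y) b → move p b ≡ b
  move-refl refl _ = refl
  moved : ∀ {y z} (p : y ≡ z) b → _≡_ {A = Σ A B} (z , move p b) (y , b)
  moved refl _ = refl
  iso : B x ↔ Σ A B
  iso = mk↔ₛ′ (x ,_) (λ (y , b) → move (irr y x) b) (λ (y , b) → moved (irr y x) b) (move-refl (irr x x))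
finite-Σ-dec (no ¬x) _ _ =
  0 , mk↔ₛ′ (λ ()) (λ (x , _) → contradiction x ¬x) (λ (x , _) → contradiction x ¬x) λ ()

finite-Σ-Fin : ∀ {n} {B : Fin n → Set b} → (∀ i → Finite (B i)) → Finite (Σ (Fin n) B)
finite-Σ-Fin {n = zero}  _   = 0 , mk↔ₛ′ (λ ()) (λ ()) (λ ()) λ ()
finite-Σ-Fin {n = suc n} fin = finite-↔
  (mk↔ₛ′ (λ { (inj₁ b) → zero , b ; (inj₂ (i , b)) → suc i , b })
         (λ { (zero , b) → inj₁ b ; (suc i , b) → inj₂ (i , b) })
         (λ { (zero , _) → refl ; (suc _ , _) → refl })
         (λ { (inj₁ _) → refl ; (inj₂ _) → refl }))
  (finite-⊎ (fin zero) (finite-Σ-Fin (fin ∘ suc)))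

acyclic⇒noetherian : ∀ {n} {R : Rel (Fin n) a} → (∀ v → ¬ TransClosure R v v) →
                     WellFounded (λ v u → TransClosure R u v)
acyclic⇒noetherian {R = R} acyclic = spo-noetherian {_≈_ = _≡_} {_⊏_ = TransClosure R} record
  { isEquivalence = ≡.isEquivalence
  ; irrefl        = λ { refl c → acyclic _ c }
  ; trans         = Plus._++_
  ; <-resp-≈      = (λ { refl c → c }) , (λ { refl c → c })
  }

module _ (E : FiniteDigraph) (acyclic : FiniteDigraph.Acyclic E) (w : FiniteDigraph.Vertex E) where
  open FiniteDigraph E

  finite-paths : ∀ u → Acc (λ v u → TransClosure Arrow u v) u → Finite (Path u w)
  finite-paths u (acc rec) = finite-↔
    (mk↔ₛ′ (λ { (inj₁ refl) → ε ; (inj₂ (e , eq , p)) → (e , eq , refl) ◅ p })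
           (λ { ε → inj₁ refl ; ((e , eq , refl) ◅ p) → inj₂ (e , eq , p) })
           (λ { ε → refl ; ((e , eq , refl) ◅ p) → refl })
           (λ { (inj₁ refl) → refl ; (inj₂ (e , eq , p)) → refl }))
    (finite-⊎ (finite-dec (u Fin.≟ w) (λ { refl refl → refl }))
      (finite-Σ-Fin λ e → finite-Σ-dec (s e Fin.≟ u) (λ { refl refl → refl })
        λ eq → finite-paths (t e) (rec [ e , eq , refl ])))

  finite-pathsTo : Finite (PathTo w)
  finite-pathsTo = finite-Σ-Fin λ u → finite-paths u (acyclic⇒noetherian acyclic u)

module _ (E : FiniteDigraph) where
  open FiniteDigraph E

  route : ∀ {u v} → Path u v → List Edge
  route ε             = []
  route ((e , _) ◅ p) = e ∷ route p

module Reaching (E : FiniteDigraph) (w : FiniteDigraph.Vertex E)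
                (reach? : ∀ u → Dec (FiniteDigraph.Path E u w)) where
  open FiniteDigraph E

  -- True makes membership in the subgraph a proposition, which Path u w is not.
  Reaches : Vertex → Set
  Reaches u = True (reach? u)

  finite-reaching : Finite (Σ Vertex Reaches)
  finite-reaching = finite-Σ-Fin λ u → finite-dec (T? _) T-irrelevant

  finite-reachingEdges : Finite (Σ Edge (Reaches ∘ t))
  finite-reachingEdges = finite-Σ-Fin λ e → finite-dec (T? _) T-irrelevant

  private
    module V = Inverse (proj₂ finite-reaching)
    module W = Inverse (proj₂ finite-reachingEdges)

  ι : Fin (proj₁ finite-reaching) → Vertex
  ι g = proj₁ (V.to g)

  ι-path : ∀ g → Path (ι g) w
  ι-path g = toWitness (proj₂ (V.to g))

  ι-injective : ∀ {g h} → ι g ≡ ι h → g ≡ h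
  ι-injective {g} {h} eq = ≡.trans (≡.sym (V.strictlyInverseʳ g))
    (≡.trans (≡.cong V.from (Σ-≡,≡→≡ (eq , T-irrelevant _ _))) (V.strictlyInverseʳ h))

  restrict : ∀ {u} → Path u w → Fin (proj₁ finite-reaching)
  restrict {u} p = V.from (u , fromWitness p)

  ι-restrict : ∀ {u} (p : Path u w) → ι (restrict p) ≡ u
  ι-restrict p = ≡.cong proj₁ (V.strictlyInverseˡ _)

  ιₑ : Fin (proj₁ finite-reachingEdges) → Edge
  ιₑ e = proj₁ (W.to e)

  ιₑ-path : ∀ e → Path (t (ιₑ e)) w
  ιₑ-path e = toWitness (proj₂ (W.to e))

  ιₑ-injective : ∀ {e f} → ιₑ e ≡ ιₑ f → e ≡ f
  ιₑ-injective {e} {f} eq = ≡.trans (≡.sym (W.strictlyInverseʳ e))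
    (≡.trans (≡.cong W.from (Σ-≡,≡→≡ (eq , T-irrelevant _ _))) (W.strictlyInverseʳ f))

  G : FiniteDigraph
  G = record
    { #vertices = proj₁ finite-reaching
    ; #edges    = proj₁ finite-reachingEdges
    ; s         = λ e → restrict ((ιₑ e , refl , refl) ◅ ιₑ-path e)
    ; t         = λ e → restrict (ιₑ-path e)
    }
  module G = FiniteDigraph G

  #edges-≤ : G.#edges ≤ #edges
  #edges-≤ = Fin.injective⇒≤ ιₑ-injective

  ι-arrow : ∀ {g h} → G.Arrow g h → Arrow (ι g) (ι h)
  ι-arrow (e , p , q) = ιₑ e
    , ≡.trans (≡.sym (ι-restrict ((ιₑ e , refl , refl) ◅ ιₑ-path e))) (≡.cong ι p)
    , ≡.trans (≡.sym (ι-restrict (ιₑ-path e))) (≡.cong ι q)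

  ι⋆ : ∀ {g h} → G.Path g h → Path (ι g) (ι h)
  ι⋆ = Star.gmap ι ι-arrow

  sink : G.Vertex
  sink = restrict ε

  ι-sink : ι sink ≡ w
  ι-sink = ι-restrict ε

  lift-arrow : ∀ {u v} (x : Arrow u v) {h} → v ≡ ι h →
               ∃[ g ] ι g ≡ u × ∃[ y ] proj₁ (ι-arrow {g} {h} y) ≡ proj₁ x
  lift-arrow {u} {v} (e , refl , refl) {h} eq =
    G.s e′ , ≡.trans (ι-restrict _) (≡.cong s e′≡e)
    , (e′ , refl , ι-injective (≡.trans (ι-restrict _) (≡.trans (≡.cong t e′≡e) eq))) , e′≡e
    where
    te∈ : Reaches (t e)
    te∈ = fromWitness (≡.subst (λ v → Path v w) (≡.sym eq) (ι-path h))
    e′ : G.Edge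
    e′ = W.from (e , te∈)
    e′≡e : ιₑ e′ ≡ e
    e′≡e = ≡.cong proj₁ (W.strictlyInverseˡ (e , te∈))

  lift-path : ∀ {u} (p : Path u w) → ∃[ g ] ι g ≡ u × ∃[ q ] route E (ι⋆ {g} {sink} q) ≡ route E p
  lift-path ε = sink , ι-sink , ε , refl
  lift-path (x ◅ p) with lift-path p
  ... | h , eq , q , r with lift-arrow x (≡.sym eq)
  ...   | g , eq′ , y , r′ = g , eq′ , y ◅ q , ≡.cong₂ _∷_ r′ r

  toSink : ∀ g → G.Path g sink
  toSink g with lift-path (ι-path g)
  ... | h , eq , p , _ = ≡.subst (λ g → G.Path g sink) (ι-injective eq) p

  connected : G.Connected
  connected g h = Star.map fwd (toSink g) ◅◅ symmetric _ (Star.map fwd (toSink h))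

  ι⁺ : ∀ {g h} → TransClosure G.Arrow g h → TransClosure Arrow (ι g) (ι h)
  ι⁺ [ x ]   = [ ι-arrow x ]
  ι⁺ (x ∷ c) = ι-arrow x ∷ ι⁺ c

  module _ (isSink : Sink w) (acyclic : ∀ {v} → Path v w → ¬ TransClosure Arrow v v) where

    acyclic-G : G.Acyclic
    acyclic-G g c = acyclic (ι-path g) (ι⁺ c)

    isSink-G : G.Sink sink
    isSink-G e eq with ι-arrow (e , eq , refl)
    ... | f , sf≡ , _ = isSink f (≡.trans sf≡ ι-sink)

    unique-G : ∀ {g} → G.Sink g → g ≡ sink
    unique-G {g} sk with toSink g
    ... | ε                = refl
    ... | (e , se≡ , _) ◅ _ = contradiction se≡ (sk e)

    finite-pathsTo-G : Finite (G.PathTo sink)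
    finite-pathsTo-G = finite-pathsTo G acyclic-G sink

    sinkPaths : SinkPaths G.#edges (proj₁ finite-pathsTo-G)
    sinkPaths = record
      { graph     = G
      ; edges     = refl
      ; connected = connected
      ; acyclic   = acyclic-G
      ; sink      = sink
      ; isSink    = isSink-G
      ; unique    = unique-G
      ; count     = proj₂ finite-pathsTo-G
      }

SP-suc : ∀ N → SP N < SP (suc N)
SP-suc N = proj₂ (proj₂ (SP-maximum (suc N))) (suc (SP N))
  (≡.subst (SinkPaths (suc N)) (≡.cong suc (ℕ.+-identityʳ (SP N))) (attach 0 (proj₁ (proj₂ (SP-maximum N)))))

SP-mono-≤ : ∀ {M N} → M ≤ N → SP M ≤ SP N
SP-mono-≤ M≤N = go (ℕ.≤⇒≤′ M≤N)
  where
  go : ∀ {M N} → M ≤′ N → SP M ≤ SP N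
  go ≤′-refl           = ℕ.≤-refl
  go (≤′-step {n} M≤n) = ℕ.≤-trans (go M≤n) (ℕ.<⇒≤ (SP-suc n))

sinkPaths⇒edgeBound-≤ : ∀ {m k n} (1≤n : 1 ≤ n) → n ≤ k → SinkPaths m k → edgeBound n 1≤n ≤ m
sinkPaths⇒edgeBound-≤ {m} {k} {n} 1≤n n≤k S = ℕ.≮⇒≥ λ m<b → ℕ.<-irrefl refl (begin-strict
  k                      ≤⟨ proj₂ (proj₂ (SP-maximum m)) k S ⟩
  SP m                   <⟨ SP-suc m ⟩
  SP (suc m)             ≤⟨ SP-mono-≤ m<b ⟩
  SP (edgeBound n 1≤n)   ≤⟨ proj₁ (proj₂ (edgeBound-maximum n 1≤n)) ⟩
  n                      ≤⟨ n≤k ⟩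
  k                      ∎)
  where open ℕ.≤-Reasoning

module LinearAlgebra {c ℓ} (K : Field c ℓ) where
  open Field K hiding (zero) renaming (refl to ≈-refl)
  open import Algebra.Properties.Semiring.Sum semiring
    using (sum; sum-cong-≋; sum-remove; ∑-distrib-+; ∑-comm; *-distribˡ-sum; *-distribʳ-sum;
           sum-replicate-zero)
  open import Algebra.Properties.Ring ring using (-‿distribˡ-*; -‿distribʳ-*)
  open import Relation.Binary.Reasoning.Setoid setoid

  *-nonzero : ∀ {x y} → ¬ x ≈ 0# → ¬ y ≈ 0# → ¬ x * y ≈ 0#
  *-nonzero {x} {y} x≉0 y≉0 xy≈0 with inverse x x≉0
  ... | z , xz≈1 = y≉0 (begin
    y             ≈⟨ *-identityˡ y ⟨
    1# * y        ≈⟨ *-congʳ xz≈1 ⟨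
    x * z * y     ≈⟨ *-congʳ (*-comm x z) ⟩
    z * x * y     ≈⟨ *-assoc z x y ⟩
    z * (x * y)   ≈⟨ *-congˡ xy≈0 ⟩
    z * 0#        ≈⟨ zeroʳ z ⟩
    0#            ∎)

  sum-zero : ∀ {n} {t : Fin n → Carrier} → (∀ i → t i ≈ 0#) → sum t ≈ 0#
  sum-zero {n} t≈0 = trans (sum-cong-≋ t≈0) (sum-replicate-zero n)

  sum-single : ∀ {n} {t : Fin n → Carrier} i → (∀ j → j ≢ i → t j ≈ 0#) → sum t ≈ t i
  sum-single {suc n} {t} i t≈0 = begin
    sum t                      ≈⟨ sum-remove t ⟩
    t i + sum (removeAt t i)   ≈⟨ +-congˡ (sum-zero λ j → t≈0 (punchIn i j) (Fin.punchInᵢ≢i i j)) ⟩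
    t i + 0#                   ≈⟨ +-identityʳ (t i) ⟩
    t i                        ∎

  unit : ∀ {n} → Fin n → Fin n → Carrier
  unit i j with i Fin.≟ j
  ... | yes _ = 1#
  ... | no _  = 0#

  unit-diag : ∀ {n} (i : Fin n) → unit i i ≈ 1#
  unit-diag i with i Fin.≟ i
  ... | yes _  = ≈-refl
  ... | no i≢i = contradiction refl i≢i

  unit-off : ∀ {n} {i j : Fin n} → i ≢ j → unit i j ≈ 0#
  unit-off {i = i} {j} i≢j with i Fin.≟ j
  ... | yes i≡j = contradiction i≡j i≢j
  ... | no _    = ≈-refl

  Dependent : ∀ {d N} → (Fin N → Fin d → Carrier) → Set (c ⊔ ℓ)
  Dependent {N = N} V =
    Σ[ x ∈ (Fin N → Carrier) ] (∃[ k ] ¬ x k ≈ 0#) × (∀ i → sum (λ k → x k * V k i) ≈ 0#)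

  dependent : ∀ {d N} → d < N → (V : Fin N → Fin d → Carrier) → ¬ ¬ Dependent V
  dependent {zero}  {suc N} _         V k = k ((λ _ → 1#) , (zero , 1≉0) , λ ())
  dependent {suc d} {suc N} (s≤s d<N) V k =
    ¬¬-decidable (λ i → V i zero ≈ 0#) λ zero? → cases zero? (Fin.any? (¬? ∘ zero?))
    where
    cases : (∀ i → Dec (V i zero ≈ 0#)) → Dec (∃[ i ] ¬ V i zero ≈ 0#) → _
    cases zero? (no none) = dependent (ℕ.m≤n⇒m≤1+n d<N) (λ i → V i ∘ suc) λ (x , x≉0 , eq) → k (x , x≉0 , λ
      { zero    → sum-zero λ i →
                    trans (*-congˡ (decidable-stable (zero? i) λ ≉0 → none (i , ≉0))) (zeroʳ (x i))
      ; (suc j) → eq j })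
    cases _ (yes (p , Vp≉0)) = dependent d<N V′ λ (x , (i , xi≉0) , eq) → k
      ( insertAt (λ i → x i * V p zero) p (- sum (λ i → x i * r i zero))
      , (punchIn p i , λ ≈0 → *-nonzero xi≉0 Vp≉0 (trans (reflexive (≡.sym (insertAt-punchIn _ p _ i))) ≈0))
      , λ j → begin
        sum (λ i → insertAt (λ i → x i * V p zero) p (- sum (λ i → x i * r i zero)) i * V i j)
          ≈⟨ sum-remove {i = p} (λ i →
               insertAt (λ i → x i * V p zero) p (- sum (λ i → x i * r i zero)) i * V i j) ⟩
        _ * V p j + sum (λ i → insertAt (λ i → x i * V p zero) p _ (punchIn p i) * r i j)
          ≈⟨ +-cong (*-congʳ (reflexive (insertAt-lookup _ p _)))
                    (sum-cong-≋ λ i → *-congʳ (reflexive (insertAt-punchIn _ p _ i))) ⟩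
        (- sum (λ i → x i * r i zero)) * V p j + sum (λ i → x i * V p zero * r i j)
          ≈⟨ eliminate x eq j ⟩
        0# ∎)
      where
      -- Gaussian elimination without division by the pivot.
      r : Fin N → Fin (suc d) → Carrier
      r i = V (punchIn p i)
      V′ : Fin N → Fin d → Carrier
      V′ i j = V p zero * r i (suc j) + - (r i zero * V p (suc j))
      eliminate : ∀ (x : Fin N → Carrier) → (∀ j → sum (λ i → x i * V′ i j) ≈ 0#) → ∀ j →
                  (- sum (λ i → x i * r i zero)) * V p j + sum (λ i → x i * V p zero * r i j) ≈ 0#
      eliminate x eq j = begin
        (- S) * V p j + sum (λ i → x i * V p zero * r i j)
          ≈⟨ +-congʳ (trans (sym (-‿distribˡ-* S (V p j))) (-‿distribʳ-* S (V p j))) ⟩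
        S * - V p j + sum (λ i → x i * V p zero * r i j)
          ≈⟨ +-congʳ (*-distribʳ-sum (- V p j) (λ i → x i * r i zero)) ⟩
        sum (λ i → x i * r i zero * - V p j) + sum (λ i → x i * V p zero * r i j)
          ≈⟨ ∑-distrib-+ (λ i → x i * r i zero * - V p j) (λ i → x i * V p zero * r i j) ⟨
        sum (λ i → x i * r i zero * - V p j + x i * V p zero * r i j)
          ≈⟨ sum-cong-≋ (λ i → trans (+-comm _ _) (trans (+-cong (*-assoc _ _ _) (*-assoc _ _ _))
               (trans (sym (distribˡ (x i) _ _)) (*-congˡ (+-congˡ (sym (-‿distribʳ-* _ _))))))) ⟩
        sum (λ i → x i * (V p zero * r i j + - (r i zero * V p j)))
          ≈⟨ vanish j ⟩
        0# ∎
        where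
        S = sum (λ i → x i * r i zero)
        vanish : ∀ j → sum (λ i → x i * (V p zero * r i j + - (r i zero * V p j))) ≈ 0#
        vanish zero    = sum-zero λ i →
          trans (*-congˡ (trans (+-congˡ (-‿cong (*-comm _ _))) (-‿inverseʳ _))) (zeroʳ (x i))
        vanish (suc j) = eq j

  -- A dependency between the coefficient vectors aₖ would be one between the vectors α eₖ = Σⱼ aₖⱼ uⱼ.
  spanning-≤ : ∀ {n P α} → ¬ α ≈ 0# → (u : Fin P → Fin n → Carrier) (a : Fin n → Fin P → Carrier) →
               (∀ k → sum (λ j → a k j * u j k) ≈ α) →
               (∀ k i → i ≢ k → sum (λ j → a k j * u j i) ≈ 0#) → n ≤ P
  spanning-≤ {n} {P} {α} α≉0 u a diag off = ℕ.≮⇒≥ λ P<n → dependent P<n a λ (x , (k , xk≉0) , eq) →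
    *-nonzero xk≉0 α≉0 (begin
      x k * α
        ≈⟨ *-congˡ (diag k) ⟨
      x k * sum (λ j → a k j * u j k)
        ≈⟨ sum-single k (λ l l≢k → trans (*-congˡ (off l k (l≢k ∘ ≡.sym))) (zeroʳ (x l))) ⟨
      sum (λ l → x l * sum (λ j → a l j * u j k))
        ≈⟨ sum-cong-≋ (λ l → trans (*-distribˡ-sum (x l) (λ j → a l j * u j k))
             (sum-cong-≋ λ j → sym (*-assoc (x l) (a l j) (u j k)))) ⟩
      sum (λ l → sum (λ j → x l * a l j * u j k))
        ≈⟨ ∑-comm (λ l j → x l * a l j * u j k) ⟩
      sum (λ j → sum (λ l → x l * a l j * u j k))
        ≈⟨ sum-zero (λ j → trans (sym (*-distribʳ-sum (u j k) (λ l → x l * a l j)))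
             (trans (*-congʳ (eq j)) (zeroˡ (u j k)))) ⟩
      0# ∎)

module LeavittProperties {c ℓ} (K : Field c ℓ) (E : FiniteDigraph) where
  private module K = Field K
  open FiniteDigraph E
  open Leavitt K E
  open Algebra algebra using (+ᴹ-commutativeMonoid; +ᴹ-identityʳ; *ₗ-zeroˡ; *ₗ-zeroʳ; ≈ᴹ-setoid; +ᴹ-group)
  open import Algebra.Properties.Group +ᴹ-group using (inverseˡ-unique)
  open import Algebra.Properties.CommutativeSemigroup
    (CommutativeMonoid.commutativeSemigroup +ᴹ-commutativeMonoid) using (interchange)
  open import Algebra.Properties.CommutativeMonoid.Sum +ᴹ-commutativeMonoid
    using (sum; sum-cong-≋; sum-remove; sum-replicate-zero)
  open import Relation.Binary.Reasoning.Setoid ≈ᴹ-setoid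

  ∙-zeroʳ : ∀ x → x ∙ 0# ≈ 0#
  ∙-zeroʳ x = begin
    x ∙ 0#            ≈⟨ ∙-cong ≈-refl (*ₗ-zeroˡ 0#) ⟨
    x ∙ (K.0# · 0#)   ≈⟨ ∙-· K.0# x 0# ⟩
    K.0# · (x ∙ 0#)   ≈⟨ *ₗ-zeroˡ _ ⟩
    0#                ∎

  ∙-zeroˡ : ∀ x → 0# ∙ x ≈ 0#
  ∙-zeroˡ x = begin
    0# ∙ x            ≈⟨ ∙-cong (*ₗ-zeroˡ 0#) ≈-refl ⟨
    (K.0# · 0#) ∙ x   ≈⟨ ·-∙ K.0# 0# x ⟩
    K.0# · (0# ∙ x)   ≈⟨ *ₗ-zeroˡ _ ⟩
    0#                ∎

  ·-comm : ∀ k l x → k · l · x ≈ l · k · x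
  ·-comm k l x = begin
    k · l · x       ≈⟨ ·-assoc k l x ⟨
    (k K.* l) · x   ≈⟨ ·-cong (K.*-comm k l) ≈-refl ⟩
    (l K.* k) · x   ≈⟨ ·-assoc l k x ⟩
    l · k · x       ∎

  ·-cancel : ∀ {k x} → ¬ k K.≈ K.0# → k · x ≈ 0# → x ≈ 0#
  ·-cancel {k} {x} k≉0 kx≈0 with K.inverse k k≉0
  ... | l , kl≈1 = begin
    x               ≈⟨ ·-identityˡ x ⟨
    K.1# · x        ≈⟨ ·-cong (K.trans (K.sym kl≈1) (K.*-comm k l)) ≈-refl ⟩
    (l K.* k) · x   ≈⟨ ·-assoc l k x ⟩
    l · k · x       ≈⟨ ·-cong K.refl kx≈0 ⟩
    l · 0#          ≈⟨ *ₗ-zeroʳ l ⟩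
    0#              ∎

  -1·-inverseˡ : ∀ x → (K.- K.1#) · x + x ≈ 0#
  -1·-inverseˡ x = begin
    (K.- K.1#) · x + x            ≈⟨ +-cong ≈-refl (·-identityˡ x) ⟨
    (K.- K.1#) · x + K.1# · x     ≈⟨ ·-distribʳ x (K.- K.1#) K.1# ⟨
    (K.- K.1# K.+ K.1#) · x       ≈⟨ ·-cong (K.-‿inverseˡ K.1#) ≈-refl ⟩
    K.0# · x                      ≈⟨ *ₗ-zeroˡ x ⟩
    0#                            ∎

  -‿≈-1· : ∀ x → - x ≈ (K.- K.1#) · x
  -‿≈-1· x = ≈-sym (inverseˡ-unique _ x (-1·-inverseˡ x))

  -- The ℤ-grading as a representation on two-sided series Σ fₖ tᵏ: an edge e acts as e t, a ghost edge e* as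
  -- e* t⁻¹.  With an index set ℕ the relation ck would fail at index 0.
  act : Expr → (ℤ → Expr) → ℤ → Expr
  act (vertex v) f k = vertex v ∙ f k
  act (edge e)   f k = edge e ∙ f (ℤ.pred k)
  act (ghost e)  f k = ghost e ∙ f (ℤ.suc k)
  act 0#         f k = 0#
  act (x + y)    f k = act x f k + act y f k
  act (- x)      f k = (K.- K.1#) · act x f k
  act (a · x)    f k = a · act x f k
  act (x ∙ y)    f k = act x (act y f) k

  act-cong : ∀ x {f g} → (∀ k → f k ≈ g k) → ∀ k → act x f k ≈ act x g k
  act-cong (vertex v) p k = ∙-cong ≈-refl (p k)
  act-cong (edge e)   p k = ∙-cong ≈-refl (p (ℤ.pred k))
  act-cong (ghost e)  p k = ∙-cong ≈-refl (p (ℤ.suc k))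
  act-cong 0#         p k = ≈-refl
  act-cong (x + y)    p k = +-cong (act-cong x p k) (act-cong y p k)
  act-cong (- x)      p k = ·-cong K.refl (act-cong x p k)
  act-cong (a · x)    p k = ·-cong K.refl (act-cong x p k)
  act-cong (x ∙ y)    p k = act-cong x (act-cong y p) k

  act-+ : ∀ x f g k → act x (λ i → f i + g i) k ≈ act x f k + act x g k
  act-+ (vertex v) f g k = ∙-distribˡ _ _ _
  act-+ (edge e)   f g k = ∙-distribˡ _ _ _
  act-+ (ghost e)  f g k = ∙-distribˡ _ _ _
  act-+ 0#         f g k = ≈-sym (+-identityˡ 0#)
  act-+ (x + y)    f g k = ≈-trans (+-cong (act-+ x f g k) (act-+ y f g k)) (interchange _ _ _ _)
  act-+ (- x)      f g k = ≈-trans (·-cong K.refl (act-+ x f g k)) (·-distribˡ _ _ _)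
  act-+ (a · x)    f g k = ≈-trans (·-cong K.refl (act-+ x f g k)) (·-distribˡ _ _ _)
  act-+ (x ∙ y)    f g k = ≈-trans (act-cong x (act-+ y f g) k) (act-+ x _ _ k)

  act-· : ∀ x a f k → act x (λ i → a · f i) k ≈ a · act x f k
  act-· (vertex v) a f k = ∙-· _ _ _
  act-· (edge e)   a f k = ∙-· _ _ _
  act-· (ghost e)  a f k = ∙-· _ _ _
  act-· 0#         a f k = ≈-sym (*ₗ-zeroʳ a)
  act-· (x + y)    a f k = ≈-trans (+-cong (act-· x a f k) (act-· y a f k)) (≈-sym (·-distribˡ _ _ _))
  act-· (- x)      a f k = ≈-trans (·-cong K.refl (act-· x a f k)) (·-comm _ _ _)
  act-· (b · x)    a f k = ≈-trans (·-cong K.refl (act-· x a f k)) (·-comm _ _ _)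
  act-· (x ∙ y)    a f k = ≈-trans (act-cong x (act-· y a f) k) (act-· x _ _ k)

  act-ee* : ∀ es f k →
    act (List.foldr _+_ 0# (List.map (λ e → edge e ∙ ghost e) es)) f k
      ≈ List.foldr _+_ 0# (List.map (λ e → edge e ∙ ghost e) es) ∙ f k
  act-ee* []       f k = ≈-sym (∙-zeroˡ (f k))
  act-ee* (e ∷ es) f k rewrite ℤ.suc-pred k =
    ≈-trans (+-cong (≈-sym (∙-assoc _ _ _)) (act-ee* es f k)) (≈-sym (∙-distribʳ _ _ _))

  ∙-∙ : ∀ {x y z} u → x ∙ y ≈ z → x ∙ (y ∙ u) ≈ z ∙ u
  ∙-∙ u p = ≈-trans (≈-sym (∙-assoc _ _ u)) (∙-cong p ≈-refl)

  act-resp : ∀ {x y} → x ≈ y → ∀ f k → act x f k ≈ act y f k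
  act-resp ≈-refl f k = ≈-refl
  act-resp (≈-sym p) f k = ≈-sym (act-resp p f k)
  act-resp (≈-trans p q) f k = ≈-trans (act-resp p f k) (act-resp q f k)
  act-resp (+-cong p q) f k = +-cong (act-resp p f k) (act-resp q f k)
  act-resp (-‿cong p) f k = ·-cong K.refl (act-resp p f k)
  act-resp (·-cong a≈b p) f k = ·-cong a≈b (act-resp p f k)
  act-resp (∙-cong {x = x} p q) f k = ≈-trans (act-cong x (act-resp q f) k) (act-resp p _ k)
  act-resp (+-assoc x y z) f k = +-assoc _ _ _
  act-resp (+-comm x y) f k = +-comm _ _
  act-resp (+-identityˡ x) f k = +-identityˡ _
  act-resp (-‿inverseˡ x) f k = -1·-inverseˡ _
  act-resp (·-distribˡ a x y) f k = ·-distribˡ _ _ _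
  act-resp (·-distribʳ x a b) f k = ·-distribʳ _ _ _
  act-resp (·-assoc a b x) f k = ·-assoc _ _ _
  act-resp (·-identityˡ x) f k = ·-identityˡ _
  act-resp (∙-assoc x y z) f k = ≈-refl
  act-resp (∙-distribˡ x y z) f k = act-+ x _ _ k
  act-resp (∙-distribʳ x y z) f k = ≈-refl
  act-resp (·-∙ a x y) f k = ≈-refl
  act-resp (∙-· a x y) f k = act-· x a _ k
  act-resp (v∙v v) f k = ∙-∙ (f k) (v∙v v)
  act-resp (v∙w v≢w) f k = ≈-trans (∙-∙ (f k) (v∙w v≢w)) (∙-zeroˡ _)
  act-resp (s∙e e) f k = ∙-∙ _ (s∙e e)
  act-resp (e∙t e) f k = ∙-∙ _ (e∙t e)
  act-resp (t∙e* e) f k = ∙-∙ _ (t∙e* e)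
  act-resp (e*∙s e) f k = ∙-∙ _ (e*∙s e)
  act-resp (e*∙e e) f k rewrite ℤ.pred-suc k = ∙-∙ (f k) (e*∙e e)
  act-resp (e*∙f e≢f) f k rewrite ℤ.pred-suc k = ≈-trans (∙-∙ (f k) (e*∙f e≢f)) (∙-zeroˡ _)
  act-resp (ck v ¬sink) f k = ≈-trans (∙-cong (ck v ¬sink) ≈-refl)
    (≈-sym (act-ee* (filter (λ e → s e Fin.≟ v) (List.allFin #edges)) f k))

  word word* : List Edge → Vertex → Expr
  word []       w = vertex w
  word (e ∷ es) w = edge e ∙ word es w
  word* []       w = vertex w
  word* (e ∷ es) w = word* es w ∙ ghost e

  ⟦_⟧ₚ ⟦_⟧ₚ* : ∀ {u w} → Path u w → Expr
  ⟦_⟧ₚ  {w = w} p = word (route E p) w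
  ⟦_⟧ₚ* {w = w} p = word* (route E p) w

  source∙path : ∀ {u w} (p : Path u w) → vertex u ∙ ⟦ p ⟧ₚ ≈ ⟦ p ⟧ₚ
  source∙path {u} ε = v∙v u
  source∙path ((e , refl , _) ◅ p) = ∙-∙ _ (s∙e e)

  word∙target : ∀ es w → word es w ∙ vertex w ≈ word es w
  word∙target []       w = v∙v w
  word∙target (e ∷ es) w = ≈-trans (∙-assoc _ _ _) (∙-cong ≈-refl (word∙target es w))

  edge∙path : ∀ e {u w} (p : Path u w) → t e ≢ u → edge e ∙ ⟦ p ⟧ₚ ≈ 0#
  edge∙path e {u} p te≢u = begin
    edge e ∙ ⟦ p ⟧ₚ                                  ≈⟨ ∙-cong (e∙t e) (source∙path p) ⟨
    (edge e ∙ vertex (t e)) ∙ (vertex u ∙ ⟦ p ⟧ₚ)    ≈⟨ ∙-assoc _ _ _ ⟩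
    edge e ∙ (vertex (t e) ∙ (vertex u ∙ ⟦ p ⟧ₚ))    ≈⟨ ∙-cong ≈-refl (∙-assoc _ _ _) ⟨
    edge e ∙ ((vertex (t e) ∙ vertex u) ∙ ⟦ p ⟧ₚ)    ≈⟨ ∙-cong ≈-refl (∙-cong (v∙w te≢u) ≈-refl) ⟩
    edge e ∙ (0# ∙ ⟦ p ⟧ₚ)                           ≈⟨ ∙-cong ≈-refl (∙-zeroˡ _) ⟩
    edge e ∙ 0#                                      ≈⟨ ∙-zeroʳ _ ⟩
    0#                                               ∎

  path*∙path : ∀ {u w} (p : Path u w) → ⟦ p ⟧ₚ* ∙ ⟦ p ⟧ₚ ≈ vertex w
  path*∙path {u} ε = v∙v u
  path*∙path {w = w} ((e , _ , refl) ◅ p) = begin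
    (⟦ p ⟧ₚ* ∙ ghost e) ∙ (edge e ∙ ⟦ p ⟧ₚ)     ≈⟨ ∙-assoc _ _ _ ⟩
    ⟦ p ⟧ₚ* ∙ (ghost e ∙ (edge e ∙ ⟦ p ⟧ₚ))     ≈⟨ ∙-cong ≈-refl (∙-assoc _ _ _) ⟨
    ⟦ p ⟧ₚ* ∙ ((ghost e ∙ edge e) ∙ ⟦ p ⟧ₚ)     ≈⟨ ∙-cong ≈-refl (∙-cong (e*∙e e) ≈-refl) ⟩
    ⟦ p ⟧ₚ* ∙ (vertex (t e) ∙ ⟦ p ⟧ₚ)           ≈⟨ ∙-cong ≈-refl (source∙path p) ⟩
    ⟦ p ⟧ₚ* ∙ ⟦ p ⟧ₚ                            ≈⟨ path*∙path p ⟩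
    vertex w                                    ∎

  path≈0⇒target≈0 : ∀ {u w} (p : Path u w) → ⟦ p ⟧ₚ ≈ 0# → vertex w ≈ 0#
  path≈0⇒target≈0 p p≈0 = ≈-trans (≈-sym (path*∙path p)) (≈-trans (∙-cong ≈-refl p≈0) (∙-zeroʳ _))

  source≈0⇒target≈0 : ∀ {u w} → Path u w → vertex u ≈ 0# → vertex w ≈ 0#
  source≈0⇒target≈0 p u≈0 = path≈0⇒target≈0 p
    (≈-trans (≈-sym (source∙path p)) (≈-trans (∙-cong u≈0 ≈-refl) (∙-zeroˡ _)))

  all≈0 : (∀ v → vertex v ≈ 0#) → ∀ x → x ≈ 0#
  all≈0 z (vertex v) = z v
  all≈0 z (edge e)   = ≈-trans (≈-sym (e∙t e)) (≈-trans (∙-cong ≈-refl (z (t e))) (∙-zeroʳ _))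
  all≈0 z (ghost e)  = ≈-trans (≈-sym (e*∙s e)) (≈-trans (∙-cong ≈-refl (z (s e))) (∙-zeroʳ _))
  all≈0 z 0#         = ≈-refl
  all≈0 z (x + y)    = ≈-trans (+-cong (all≈0 z x) (all≈0 z y)) (+-identityˡ 0#)
  all≈0 z (- x)      = ≈-trans (≈-sym (≈-trans (+-cong ≈-refl (all≈0 z x)) (+ᴹ-identityʳ _))) (-‿inverseˡ x)
  all≈0 z (a · x)    = ≈-trans (·-cong K.refl (all≈0 z x)) (*ₗ-zeroʳ a)
  all≈0 z (x ∙ y)    = ≈-trans (∙-cong (all≈0 z x) ≈-refl) (∙-zeroˡ y)

  targets≈0⇒vertex≈0 : ∀ v → ¬ Sink v → (∀ e → s e ≡ v → vertex (t e) ≈ 0#) → vertex v ≈ 0#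
  targets≈0⇒vertex≈0 v ¬sink z = ≈-trans (ck v ¬sink) (go (List.allFin #edges))
    where
    go : ∀ es → List.foldr _+_ 0# (List.map (λ e → edge e ∙ ghost e) (filter (λ e → s e Fin.≟ v) es)) ≈ 0#
    go [] = ≈-refl
    go (e ∷ es) with s e Fin.≟ v
    ... | no _   = go es
    ... | yes eq = ≈-trans (+-cong e≈0 (go es)) (+-identityˡ 0#)
      where
      e≈0 : edge e ∙ ghost e ≈ 0#
      e≈0 = ≈-trans (∙-cong ≈-refl (≈-sym (t∙e* e)))
              (≈-trans (∙-cong ≈-refl (≈-trans (∙-cong (z e eq) ≈-refl) (∙-zeroˡ _))) (∙-zeroʳ _))

  act-word : ∀ es w f k → act (word es w) f k ≈ word es w ∙ f (k ℤ.- + length es)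
  act-word [] w f k rewrite ℤ.+-identityʳ k = ≈-refl
  act-word (e ∷ es) w f k
    rewrite ≡.trans (ℤ.minus-suc k (length es)) (≡.sym (ℤ.pred-+ k (ℤ.- + length es))) =
      ≈-trans (∙-cong ≈-refl (act-word es w f (ℤ.pred k))) (≈-sym (∙-assoc _ _ _))

  sum-singleᴸ : ∀ {N} {h : Fin N → Expr} j → (∀ i → i ≢ j → h i ≈ 0#) → sum h ≈ h j
  sum-singleᴸ {suc N} {h} j h≈0 = begin
    sum h                           ≈⟨ sum-remove h ⟩
    h j + sum (h ∘ punchIn j)       ≈⟨ +-cong ≈-refl (sum-cong-≋ λ i → h≈0 (punchIn j i) (Fin.punchInᵢ≢i j i)) ⟩
    h j + sum (λ (_ : Fin N) → 0#)  ≈⟨ +-cong ≈-refl (sum-replicate-zero N) ⟩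
    h j + 0#                        ≈⟨ +ᴹ-identityʳ _ ⟩
    h j                             ∎

  act-sum : ∀ {N} (h : Fin N → Expr) f k → act (sum h) f k ≈ sum (λ i → act (h i) f k)
  act-sum {zero}  h f k = ≈-refl
  act-sum {suc N} h f k = +-cong ≈-refl (act-sum (h ∘ suc) f k)

  impulse : Vertex → ℤ → Expr
  impulse v (+ 0) = vertex v
  impulse v _     = 0#

  impulse≈0 : ∀ v {k} → k ≢ + 0 → impulse v k ≈ 0#
  impulse≈0 v {+ zero}     k≢0 = contradiction refl k≢0
  impulse≈0 v {+ suc _}    _   = ≈-refl
  impulse≈0 v { ℤ.-[1+ _ ]} _  = ≈-refl

  dependent-paths⇒target≈0 :
    ∀ {w N} (p : Fin N → PathTo w) →
    (∀ {i j} → length (route E (proj₂ (p i))) ≡ length (route E (proj₂ (p j))) → i ≡ j) →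
    ∀ (a : Fin N → K.Carrier) {j} → ¬ a j K.≈ K.0# → sum (λ i → a i · ⟦ proj₂ (p i) ⟧ₚ) ≈ 0# → vertex w ≈ 0#
  dependent-paths⇒target≈0 {w} {N} p len-inj a {j} aj≉0 comb≈0 =
    path≈0⇒target≈0 (proj₂ (p j)) (≈-trans (≈-sym (word∙target _ w)) (·-cancel aj≉0 (begin
      a j · (q j ∙ vertex w)
        ≡⟨ ≡.cong (λ k → a j · (q j ∙ impulse w k)) (≡.sym (ℤ.+-inverseʳ (+ len j))) ⟩
      term j
        ≈⟨ sum-singleᴸ {h = term} j off ⟨
      sum term
        ≈⟨ sum-cong-≋ (λ i → ·-cong K.refl (act-word (route E (proj₂ (p i))) w (impulse w) (+ len j))) ⟨
      sum (λ i → act (a i · q i) (impulse w) (+ len j))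
        ≈⟨ act-sum (λ i → a i · q i) _ _ ⟨
      act (sum (λ i → a i · q i)) (impulse w) (+ len j)
        ≈⟨ act-resp comb≈0 _ _ ⟩
      0# ∎)))
    where
    len : Fin N → ℕ
    len i = length (route E (proj₂ (p i)))
    q : Fin N → Expr
    q i = ⟦ proj₂ (p i) ⟧ₚ
    term : Fin N → Expr
    term i = a i · (q i ∙ impulse w (+ len j ℤ.- + len i))
    off : ∀ i → i ≢ j → term i ≈ 0#
    off i i≢j = ≈-trans (·-cong K.refl (≈-trans (∙-cong ≈-refl (impulse≈0 w
        λ eq → i≢j (len-inj (≡.sym (ℤ.+-injective (ℤ.i-j≡0⇒i≡j (+ len j) (+ len i) eq))))))
      (∙-zeroʳ _))) (*ₗ-zeroʳ _)

module _ (E : FiniteDigraph) where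
  open FiniteDigraph E

  Plus⇒Path : ∀ {u v} → TransClosure Arrow u v → ∃[ p ] 1 ≤ length (route E {u} {v} p)
  Plus⇒Path [ x ]   = x ◅ ε , s≤s z≤n
  Plus⇒Path (x ∷ c) = x ◅ proj₁ (Plus⇒Path c) , s≤s z≤n

  length-◅◅ : ∀ {u v w} (p : Path u v) (q : Path v w) →
              length (route E (p ◅◅ q)) ≡ length (route E p) ℕ.+ length (route E q)
  length-◅◅ ε       q = refl
  length-◅◅ (_ ◅ p) q = ≡.cong suc (length-◅◅ p q)

  power : ∀ {v} → Path v v → ℕ → Path v v
  power p zero    = ε
  power p (suc i) = p ◅◅ power p i

  length-power : ∀ {v} (p : Path v v) i → length (route E (power p i)) ≡ i ℕ.* length (route E p)
  length-power p zero    = refl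
  length-power p (suc i) =
    ≡.trans (length-◅◅ p (power p i)) (≡.cong (length (route E p) ℕ.+_) (length-power p i))

  length-power-injective : ∀ {v} (p : Path v v) → 1 ≤ length (route E p) → ∀ {i j} →
                           length (route E (power p i)) ≡ length (route E (power p j)) → i ≡ j
  length-power-injective p 1≤ {i} {j} eq = ℕ.*-cancelʳ-≡ i j (length (route E p)) {{ℕ.>-nonZero 1≤}}
    (≡.trans (≡.sym (length-power p i)) (≡.trans eq (length-power p j)))

module NonzeroVertices {c ℓ} (K : Field c ℓ) (E : FiniteDigraph) where
  private module K = Field K
  open FiniteDigraph E
  open Leavitt K E
  open LeavittProperties K E

  module _ (zero? : ∀ v → Dec (vertex v ≈ 0#))
           (nonzero-acyclic : ∀ v → ¬ vertex v ≈ 0# → ¬ TransClosure Arrow v v) where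

    NonzeroArrow : Vertex → Vertex → Set (c ⊔ ℓ)
    NonzeroArrow u v = ¬ vertex u ≈ 0# × Arrow u v

    ≉0-step : ∀ v → ¬ vertex v ≈ 0# → ¬ Sink v → ∃[ e ] s e ≡ v × ¬ vertex (t e) ≈ 0#
    ≉0-step v v≉0 ¬sink with Fin.any? (λ e → (s e Fin.≟ v) ×-dec ¬? (zero? (t e)))
    ... | yes found = found
    ... | no none   = contradiction (targets≈0⇒vertex≈0 v ¬sink
                        λ e eq → decidable-stable (zero? (t e)) λ te≉0 → none (e , eq , te≉0)) v≉0

    ≉0-sink : ∀ v → Acc (λ v u → TransClosure NonzeroArrow u v) v → ¬ vertex v ≈ 0# →
              ∃[ w ] Sink w × ¬ vertex w ≈ 0#
    ≉0-sink v (acc rec) v≉0 with Fin.all? (λ e → ¬? (s e Fin.≟ v))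
    ... | yes sink = v , sink , v≉0
    ... | no ¬sink with ≉0-step v v≉0 ¬sink
    ...   | e , se≡v , te≉0 = ≉0-sink (t e) (rec [ v≉0 , e , se≡v , refl ]) te≉0

    nonzero-noetherian : WellFounded (λ v u → TransClosure NonzeroArrow u v)
    nonzero-noetherian = acyclic⇒noetherian λ v c → nonzero-acyclic v (start c) (forget c)
      where
      start : ∀ {u v} → TransClosure NonzeroArrow u v → ¬ vertex u ≈ 0#
      start [ u≉0 , _ ]     = u≉0
      start ((u≉0 , _) ∷ _) = u≉0
      forget : ∀ {u v} → TransClosure NonzeroArrow u v → TransClosure Arrow u v
      forget [ _ , x ]     = [ x ]
      forget ((_ , x) ∷ c) = x ∷ forget c

  module LeftIdeal (w : Vertex) (isSink : Sink w) where

    data Span : Expr → Set (c ⊔ ℓ) where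
      path  : ∀ {u} (p : Path u w) → Span ⟦ p ⟧ₚ
      zero  : Span 0#
      plus  : ∀ {x y} → Span x → Span y → Span (x + y)
      scale : ∀ {x} a → Span x → Span (a · x)
      resp  : ∀ {x y} → x ≈ y → Span x → Span y

    span-∙ : ∀ x → (∀ {u} (p : Path u w) → Span (x ∙ ⟦ p ⟧ₚ)) → ∀ {y} → Span y → Span (x ∙ y)
    span-∙ x f (path p)    = f p
    span-∙ x f zero        = resp (≈-sym (∙-zeroʳ x)) zero
    span-∙ x f (plus S T)  = resp (≈-sym (∙-distribˡ _ _ _)) (plus (span-∙ x f S) (span-∙ x f T))
    span-∙ x f (scale a S) = resp (≈-sym (∙-· _ _ _)) (scale a (span-∙ x f S))
    span-∙ x f (resp p S)  = resp (∙-cong ≈-refl p) (span-∙ x f S)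

    vertex-path : ∀ v {u} (p : Path u w) → Span (vertex v ∙ ⟦ p ⟧ₚ)
    vertex-path v {u} p with v Fin.≟ u
    ... | yes refl = resp (≈-sym (source∙path p)) (path p)
    ... | no v≢u   = resp (≈-sym (≈-trans (∙-cong ≈-refl (≈-sym (source∙path p)))
                       (≈-trans (∙-∙ _ (v∙w v≢u)) (∙-zeroˡ _)))) zero

    edge-path : ∀ e {u} (p : Path u w) → Span (edge e ∙ ⟦ p ⟧ₚ)
    edge-path e {u} p with t e Fin.≟ u
    ... | yes refl = path ((e , refl , refl) ◅ p)
    ... | no te≢u  = resp (≈-sym (edge∙path e p te≢u)) zero

    ghost-path : ∀ e {u} (p : Path u w) → Span (ghost e ∙ ⟦ p ⟧ₚ)
    ghost-path e ε = resp (≈-sym (≈-trans (∙-cong (≈-sym (e*∙s e)) ≈-refl)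
      (≈-trans (∙-assoc _ _ _) (≈-trans (∙-cong ≈-refl (v∙w (isSink e))) (∙-zeroʳ _))))) zero
    ghost-path e ((f , _ , refl) ◅ p) with e Fin.≟ f
    ... | yes refl = resp (≈-sym (≈-trans (∙-∙ _ (e*∙e e)) (source∙path p))) (path p)
    ... | no e≢f   = resp (≈-sym (≈-trans (∙-∙ _ (e*∙f e≢f)) (∙-zeroˡ _))) zero

    ∙-span : ∀ x {y} → Span y → Span (x ∙ y)
    ∙-span (vertex v) S = span-∙ (vertex v) (vertex-path v) S
    ∙-span (edge e)   S = span-∙ (edge e) (edge-path e) S
    ∙-span (ghost e)  S = span-∙ (ghost e) (ghost-path e) S
    ∙-span 0#         S = resp (≈-sym (∙-zeroˡ _)) zero
    ∙-span (x + y)    S = resp (≈-sym (∙-distribʳ _ _ _)) (plus (∙-span x S) (∙-span y S))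
    ∙-span (- x)      S = resp (≈-trans (≈-sym (·-∙ _ _ _)) (∙-cong (≈-sym (-‿≈-1· x)) ≈-refl))
                            (scale (K.- K.1#) (∙-span x S))
    ∙-span (a · x)    S = resp (≈-sym (·-∙ _ _ _)) (scale a (∙-span x S))
    ∙-span (x ∙ y)    S = resp (≈-sym (∙-assoc _ _ _)) (∙-span x (∙-span y S))

module _ {c ℓ} (K : Field c ℓ) (E : FiniteDigraph) {n : ℕ}
         (φ : LeavittPathAlgebra K E ≅ MatrixAlgebra K n) where
  private
    module K = Field K
    module L = Leavitt K E
  open FiniteDigraph E
  open L using (Expr; vertex; 0#; _·_; _∙_; _≈_)
  open LeavittProperties K E
  open NonzeroVertices K E
  open LinearAlgebra K
  open import Algebra.Properties.Semiring.Sum K.semiring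
    using (sum; sum-cong-≋; ∑-distrib-+; *-distribˡ-sum)
  open import Algebra.Properties.CommutativeMonoid.Sum (Algebra.+ᴹ-commutativeMonoid L.algebra)
    using () renaming (sum to sumᴸ)
  open _≅_ φ using (⟦_⟧; ∙-homo; isLeftModuleIsomorphism)
  open LeftModuleMorphisms (Algebra.rawLeftModule L.algebra) (Algebra.rawLeftModule (MatrixAlgebra K n))
    using (module IsLeftModuleIsomorphism)
  open IsLeftModuleIsomorphism isLeftModuleIsomorphism
    using (⟦⟧-cong; +ᴹ-homo; *ₗ-homo; 0ᴹ-homo; injective; surjective)

  ⟦sum⟧ : ∀ {N} (a : Fin N → K.Carrier) (h : Fin N → Expr) i j →
          ⟦ sumᴸ (λ k → a k · h k) ⟧ i j K.≈ sum (λ k → a k K.* ⟦ h k ⟧ i j)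
  ⟦sum⟧ {zero}  a h i j = 0ᴹ-homo i j
  ⟦sum⟧ {suc N} a h i j =
    K.trans (+ᴹ-homo _ _ i j) (K.+-cong (*ₗ-homo _ _ i j) (⟦sum⟧ (a ∘ suc) (h ∘ suc) i j))

  ⟦⟧≈0⇒≈0 : ∀ {x} → (∀ i j → ⟦ x ⟧ i j K.≈ K.0#) → x ≈ 0#
  ⟦⟧≈0⇒≈0 z = injective λ i j → K.trans (z i j) (K.sym (0ᴹ-homo i j))

  cycle≈0 : ∀ {v} → TransClosure Arrow v v → ¬ ¬ vertex v ≈ 0#
  cycle≈0 {v} c k = dependent {d = n ℕ.* n} {N = suc (n ℕ.* n)} ℕ.≤-refl V
    λ (a , (j , aj≉0) , eq) → k (dependent-paths⇒target≈0 p
      (λ eq → Fin.toℕ-injective (length-power-injective E (proj₁ cycle) (proj₂ cycle) eq)) a aj≉0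
      (⟦⟧≈0⇒≈0 λ i l → K.trans (⟦sum⟧ a (λ i → ⟦ proj₂ (p i) ⟧ₚ) i l)
        (K.trans (sum-cong-≋ λ r → K.*-congˡ {a r} (K.reflexive (≡.sym (≡.cong₂ ⟦ ⟦ proj₂ (p r) ⟧ₚ ⟧
          (≡.cong proj₁ (Fin.remQuot-combine {n} i l)) (≡.cong proj₂ (Fin.remQuot-combine {n} i l))))))
        (eq (combine i l)))))
    where
    cycle : ∃[ p ] 1 ≤ length (route E {v} {v} p)
    cycle = Plus⇒Path E c
    p : Fin (suc (n ℕ.* n)) → PathTo v
    p i = v , power E (proj₁ cycle) (toℕ i)
    V : Fin (suc (n ℕ.* n)) → Fin (n ℕ.* n) → K.Carrier
    V i r = ⟦ ⟦ proj₂ (p i) ⟧ₚ ⟧ (quotient {n} n r) (remainder {n} n r)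

  ∃-≉0 : ∀ {x} → ¬ x ≈ 0# → ¬ ¬ (∃[ i ] ∃[ j ] ¬ ⟦ x ⟧ i j K.≈ K.0#)
  ∃-≉0 {x} x≉0 k = ¬¬-∀-Fin {P = λ i → ∀ j → ⟦ x ⟧ i j K.≈ K.0#}
    (λ i → ¬¬-∀-Fin λ j ≉0 → k (i , j , ≉0)) (x≉0 ∘ ⟦⟧≈0⇒≈0)

  module _ {w} (isSink : Sink w) {P} (b : Fin P → List Edge)
           (cover : ∀ (p : PathTo w) → ∃[ j ] b j ≡ route E (proj₂ p)) where
    open LeftIdeal w isSink

    column : Fin n → Fin P → Fin n → K.Carrier
    column j₀ j i = ⟦ word (b j) w ⟧ i j₀

    span-column : ∀ j₀ {y} → Span y →
      Σ[ a ∈ (Fin P → K.Carrier) ] ∀ i → sum (λ j → a j K.* column j₀ j i) K.≈ ⟦ y ⟧ i j₀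
    span-column j₀ (path p) with cover (_ , p)
    ... | j , eq = (λ l → unit l j) , λ i →
      K.trans (sum-single j λ l l≢j → K.trans (K.*-congʳ (unit-off l≢j)) (K.zeroˡ _))
        (K.trans (K.*-congʳ (unit-diag j)) (K.trans (K.*-identityˡ _)
          (K.reflexive (≡.cong (λ es → ⟦ word es w ⟧ i j₀) eq))))
    span-column j₀ zero = (λ _ → K.0#) , λ i →
      K.trans (sum-zero {t = λ j → K.0# K.* column j₀ j i} λ j → K.zeroˡ _) (K.sym (0ᴹ-homo i j₀))
    span-column j₀ (plus S T) with span-column j₀ S | span-column j₀ T
    ... | a , p | a′ , p′ = (λ j → a j K.+ a′ j) , λ i →
      K.trans (sum-cong-≋ λ j → K.distribʳ (column j₀ j i) (a j) (a′ j))
        (K.trans (∑-distrib-+ (λ j → a j K.* column j₀ j i) (λ j → a′ j K.* column j₀ j i))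
          (K.trans (K.+-cong (p i) (p′ i)) (K.sym (+ᴹ-homo _ _ i j₀))))
    span-column j₀ (scale k S) with span-column j₀ S
    ... | a , p = (λ j → k K.* a j) , λ i →
      K.trans (sum-cong-≋ λ j → K.*-assoc k (a j) (column j₀ j i))
        (K.trans (K.sym (*-distribˡ-sum k (λ j → a j K.* column j₀ j i)))
          (K.trans (K.*-congˡ (p i)) (K.sym (*ₗ-homo _ _ i j₀))))
    span-column j₀ (resp x≈y S) with span-column j₀ S
    ... | a , p = a , λ i → K.trans (p i) (⟦⟧-cong x≈y i j₀)

    -- If α = ⟦ w ⟧ᵢ₀ⱼ₀ is nonzero, the columns j₀ of ⟦ L w ⟧ fill Kⁿ: column j₀ of the product of the matrix
    -- unit at (k , i₀) with ⟦ w ⟧ is α eₖ.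
    n≤#paths : ¬ vertex w ≈ 0# → ¬ ¬ n ≤ P
    n≤#paths w≉0 n≰P = ∃-≉0 w≉0 λ (i₀ , j₀ , α≉0) → n≰P (spanning-≤ α≉0 (column j₀)
      (λ k → proj₁ (coefficients i₀ j₀ k))
      (λ k → K.trans (entry i₀ j₀ k k) (K.trans (K.*-congʳ (unit-diag k)) (K.*-identityˡ _)))
      (λ k i i≢k → K.trans (entry i₀ j₀ k i) (K.trans (K.*-congʳ (unit-off i≢k)) (K.zeroˡ _))))
      where
      matrixUnit : Fin n → Fin n → Fin n → Fin n → K.Carrier
      matrixUnit k l i j = unit i k K.* unit j l
      preimage : Fin n → Fin n → Expr
      preimage k l = proj₁ (surjective (matrixUnit k l))
      coefficients : ∀ i₀ j₀ k → Σ[ a ∈ (Fin P → K.Carrier) ]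
        ∀ i → sum (λ j → a j K.* column j₀ j i) K.≈ ⟦ preimage k i₀ ∙ vertex w ⟧ i j₀
      coefficients i₀ j₀ k = span-column j₀ (∙-span (preimage k i₀) (path ε))
      entry : ∀ i₀ j₀ k i → sum (λ j → proj₁ (coefficients i₀ j₀ k) j K.* column j₀ j i)
                K.≈ unit i k K.* ⟦ vertex w ⟧ i₀ j₀
      entry i₀ j₀ k i = begin
        sum (λ j → proj₁ (coefficients i₀ j₀ k) j K.* column j₀ j i)
          ≈⟨ proj₂ (coefficients i₀ j₀ k) i ⟩
        ⟦ preimage k i₀ ∙ vertex w ⟧ i j₀
          ≈⟨ ∙-homo (preimage k i₀) (vertex w) i j₀ ⟩
        sum (λ l → ⟦ preimage k i₀ ⟧ i l K.* ⟦ vertex w ⟧ l j₀)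
          ≈⟨ sum-cong-≋ (λ l →
               K.trans (K.*-congʳ (proj₂ (surjective (matrixUnit k i₀)) L.≈-refl i l)) (K.*-assoc _ _ _)) ⟩
        sum (λ l → unit i k K.* (unit l i₀ K.* ⟦ vertex w ⟧ l j₀))
          ≈⟨ sum-single i₀ (λ l l≢i₀ →
               K.trans (K.*-congˡ (K.trans (K.*-congʳ (unit-off l≢i₀)) (K.zeroˡ _))) (K.zeroʳ _)) ⟩
        unit i k K.* (unit i₀ i₀ K.* ⟦ vertex w ⟧ i₀ j₀)
          ≈⟨ K.*-congˡ (K.trans (K.*-congʳ (unit-diag i₀)) (K.*-identityˡ _)) ⟩
        unit i k K.* ⟦ vertex w ⟧ i₀ j₀ ∎
        where open import Relation.Binary.Reasoning.Setoid K.setoid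

  ∃-nonzero-vertex : 1 ≤ n → (∀ v → Dec (vertex v ≈ 0#)) → ∃[ v ] ¬ vertex v ≈ 0#
  ∃-nonzero-vertex (s≤s _) zero? with Fin.any? (¬? ∘ zero?)
  ... | yes found = found
  ... | no none   = contradiction 1≈0 K.1≉0
    where
    one : Fin n → Fin n → K.Carrier
    one _ _ = K.1#
    x≈0 : proj₁ (surjective one) ≈ 0#
    x≈0 = all≈0 (λ v → decidable-stable (zero? v) λ v≉0 → none (v , v≉0)) _
    1≈0 : K.1# K.≈ K.0#
    1≈0 = K.trans (K.sym (proj₂ (surjective one) (L.≈-sym x≈0) zero zero)) (0ᴹ-homo zero zero)

  nonzero-acyclic : ∀ {v} → ¬ vertex v ≈ 0# → ¬ TransClosure Arrow v v
  nonzero-acyclic v≉0 c = cycle≈0 c v≉0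

  module _ {w} (isSink : Sink w) (w≉0 : ¬ vertex w ≈ 0#) (reach? : ∀ u → Dec (Path u w)) where
    private
      module R = Reaching E w reach?

      acyclic : ∀ {v} → Path v w → ¬ TransClosure Arrow v v
      acyclic p c = nonzero-acyclic (w≉0 ∘ source≈0⇒target≈0 p) c

    module _ {k} (count : Fin k ↔ R.G.PathTo R.sink) where
      private module C = Inverse count

      routes : Fin k → List Edge
      routes j = route E (R.ι⋆ (proj₂ (C.to j)))

      routes-cover : ∀ (p : PathTo w) → ∃[ j ] routes j ≡ route E (proj₂ p)
      routes-cover (_ , p) with R.lift-path p
      ... | g , _ , q , eq = C.from (g , q)
          , ≡.trans (≡.cong (λ z → route E (R.ι⋆ (proj₂ z))) (C.strictlyInverseˡ (g , q))) eq

      n≤count : ¬ ¬ n ≤ k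
      n≤count = n≤#paths isSink routes routes-cover w≉0

    sinkPathsAt : ¬ ¬ (∃[ m ] ∃[ k ] m ≤ #edges × n ≤ k × SinkPaths m k)
    sinkPathsAt goal = n≤count (SinkPaths.count S) λ n≤k → goal (_ , _ , R.#edges-≤ , n≤k , S)
      where
      S : SinkPaths R.G.#edges (proj₁ (R.finite-pathsTo-G isSink acyclic))
      S = R.sinkPaths isSink acyclic

  ∃-sinkPaths : 1 ≤ n → ¬ ¬ (∃[ m ] ∃[ k ] m ≤ #edges × n ≤ k × SinkPaths m k)
  ∃-sinkPaths 1≤n goal = ¬¬-decidable (λ v → vertex v ≈ 0#) λ zero? →
    let v , v≉0          = ∃-nonzero-vertex 1≤n zero?
        noetherian       = nonzero-noetherian zero? (λ _ → nonzero-acyclic)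
        w , isSink , w≉0 = ≉0-sink zero? (λ _ → nonzero-acyclic) v (noetherian v) v≉0
    in ¬¬-decidable (λ u → Path u w) λ reach? → sinkPathsAt isSink w≉0 reach? goal

corollary4p13 : ∀ {c ℓ} (K : Field c ℓ) (n : ℕ) (1≤n : 1 ≤ n) (E : FiniteDigraph) →
    LeavittPathAlgebra K E ≅ MatrixAlgebra K n → edgeBound n 1≤n ≤ FiniteDigraph.#edges E
corollary4p13 K n 1≤n E φ = decidable-stable (edgeBound n 1≤n ℕ.≤? FiniteDigraph.#edges E) λ ≰ →
  ∃-sinkPaths K E φ 1≤n λ (m , k , m≤ , n≤k , S) → ≰ (ℕ.≤-trans (sinkPaths⇒edgeBound-≤ 1≤n n≤k S) m≤)
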